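{- The labelled transition system of typing derivations of $\pi$LL enjoys serialisation: for every derivation $D$ and all labels $l_1,l_2$ with $\mathrm{fn}(l_1)\cap\mathrm{fn}(l_2)=\emptyset$, if $D\xrightarrow{l_1\parallel l_2}D'$, then there is a derivation $D''$ such that $D\xrightarrow{l_1}D''\xrightarrow{l_2}D'$.
   Context: **Syntax.** Names $x,y,z,\ldots$ are drawn from an infinite set with decidable equality; $X$ ranges over type variables. Types: $A,B::=A\otimes B\mid A\wp B\mid 1\mid\bot\mid A\oplus B\mid A\&B\mid X\mid X^\perp\mid\exists X.A\mid\forall X.A\mid{?}A\mid{!}A$ ($\wp$ is the "par" connective). Processes: $P,Q::=x[y].P\mid x(y).P\mid x[].P\mid x().P\mid x[\mathsf{inl}].P\mid x[\mathsf{inr}].P\mid x\triangleright(P,Q)\mid x[A].P\mid x(X).P\mid{!}x(y).P\mid{?}x[y].P\mid{?}x[x_1,x_2].P\mid{?}x[].P\mid(\nu xy)P\mid P\parallel Q\mid\mathbf 0\mid x\leftrightarrow y$. Names written inside $[\cdot]$ or $(\cdot)$ of a prefix are bound in its continuation, $x,y$ are bound in $(\nu xy)P$, $X$ is bound in $x(X).P$; free names $\mathrm{fn}(P)$ and $=_\alpha$ are as usual, and $(\nu xy)P$ is identified with $(\nu yx)P$. **Typing.** Duality is the involution with $(A\otimes B)^\perp=A^\perp\wp B^\perp$, $1^\perp=\bot$, $(A\oplus B)^\perp=A^\perp\&B^\perp$, $({?}A)^\perp={!}A^\perp$, $(\exists X.A)^\perp=\forall X.A^\perp$, $(X)^\perp=X^\perp$,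 and symmetrically. An environment $\Gamma,\Delta,\ldots$ is a finite unordered list $x_1:A_1,\ldots,x_k:A_k$ of distinct names with types; "," joins environments with disjoint names. A hyperenvironment $\mathcal G=\Gamma_1\parallel\cdots\parallel\Gamma_n$ is a finite multiset of environments, all names distinct; $\emptyset$ is the hyperenvironment with no environments ("," binds tighter than $\parallel$). ${?}\Gamma$ denotes an environment all of whose types have the form ${?}A$. Typing rules (premises $\Rightarrow$ conclusion): (Ax) $\vdash x\leftrightarrow y::x:A^\perp,y:A$. (Cut) $\vdash P::\mathcal G\parallel\Gamma,x:A\parallel\Delta,y:A^\perp\Rightarrow\ \vdash(\nu xy)P::\mathcal G\parallel\Gamma,\Delta$. (Mix) $\vdash P::\mathcal G$ and $\vdash Q::\mathcal H\Rightarrow\ \vdash P\parallel Q::\mathcal G\parallel\mathcal H$. (Mix$_0$) $\vdash\mathbf 0::\emptyset$. ($\otimes$) $\vdash P::\Gamma,y:A\parallel\Delta,x:B\Rightarrow\ \vdash x[y].P::\Gamma,\Delta,x:A\otimes B$. (1) $\vdash P::\emptyset\Rightarrow\ \vdash x[].P::x:1$. ($\wp$) $\vdash P::\Gamma,y:A,x:B\Rightarrow\ \vdash x(y).P::\Gamma,x:A\wp B$. ($\bot$) $\vdash P::\Gamma\Rightarrow\ \vdash x().P::\Gamma,x:\bot$. ($\oplus_1$) $\vdash P::\Gamma,x:A\Rightarrow\ \vdash x[\mathsf{inl}].P::\Gamma,x:A\oplus B$. ($\oplus_2$) $\vdash P::\Gamma,x:B\Rightarrow\ \vdash x[\mathsf{inr}].P::\Gamma,x:A\oplus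 B$. ($\&$) $\vdash P::\Gamma,x:A$ and $\vdash Q::\Gamma,x:B\Rightarrow\ \vdash x\triangleright(P,Q)::\Gamma,x:A\&B$. (!) $\vdash P::{?}\Gamma,y:A\Rightarrow\ \vdash{!}x(y).P::{?}\Gamma,x:{!}A$. (?) $\vdash P::\Gamma,y:A\Rightarrow\ \vdash{?}x[y].P::\Gamma,x:{?}A$. (W) $\vdash P::\Gamma\Rightarrow\ \vdash{?}x[].P::\Gamma,x:{?}A$. (C) $\vdash P::\Gamma,x_1:{?}A,x_2:{?}A\Rightarrow\ \vdash{?}x[x_1,x_2].P::\Gamma,x:{?}A$. ($\exists$) $\vdash P::\Gamma,x:B\{A/X\}\Rightarrow\ \vdash x[A].P::\Gamma,x:\exists X.B$. ($\forall$) $\vdash P::\Gamma,x:B$, $X$ not free in $\Gamma$ $\Rightarrow\ \vdash x(X).P::\Gamma,x:\forall X.B$. A typing derivation $D$ is a finite tree built with these rules; $\mathrm{proc}(D)$ is the process in its conclusion, and $\mathrm{fn}(D)=\mathrm{fn}(\mathrm{proc}(D))$. Each rule introduces exactly one process constructor, so derivations are written with the same constructors, each denoting the application of the corresponding typing rule to subderivations (e.g. $(\nu xy)D$ ends with Cut applied to $D$, $D\parallel E$ ends with Mix, $x\leftrightarrow y$ is an instance of Ax, $\mathbf 0$ is Mix$_0$). **Labels.** Action labels (Act): $x[]$, $x()$, $x[y]$, $x(y)$, $x[\mathsf{inl}]$, $x(\mathsf{inl})$, $x[\mathsf{inr}]$, $x(\mathsf{inr})$, ${?}x[y]$, ${!}x(y)$,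 ${?}x[x_1,x_2]$, ${!}x(x_1,x_2)$, ${?}x[]$, ${!}x()$, $x[A]$, $x(A)$. Labels: $\tau$, $x\leftrightarrow y$, $l$, and unordered pairs $l\parallel l'$, for $l,l'\in$ Act (writing $l\parallel l'$ presupposes $l,l'\in$ Act). In an action label $x$ is free and the names inside brackets are bound; both names of $x\leftrightarrow y$ are free; $\tau$ has no names; $\mathrm{fn},\mathrm{bn}$ of a pair are unions; $\mathrm{cn}(l)=\mathrm{fn}(l)\cup\mathrm{bn}(l)$. **Derivation transitions** (least relation closed under the following, all displayed derivations being valid, substitutions applied throughout a derivation): $\pi.D\xrightarrow{\pi}D$ for $\pi$ of the form $x[y],x(y),x[],x(),x[\mathsf{inl}],x[\mathsf{inr}],x[A],{?}x[y],{!}x(y)$; $x\triangleright(D,E)\xrightarrow{x(\mathsf{inl})}D$; $x\triangleright(D,E)\xrightarrow{x(\mathsf{inr})}E$; $x(X).D\xrightarrow{x(A)}D\{A/X\}$; ${?}x[].D\xrightarrow{{?}x[]}x().D$; ${?}x[x_1,x_2].D\xrightarrow{{?}x[x_1,x_2]}x_1(x_2).D$; ${!}x(x').D\xrightarrow{{!}x()}{?}z_1[].\cdots{?}z_n[].x[].\mathbf 0$ if $\mathrm{fn}(D)\setminus\{x'\}=\{z_1,\ldots,z_n\}$; ${!}x(x').D\xrightarrow{{!}x(x_1,x_2)}{?}z_1[z_1\sigma_1,z_1\sigma_2].\cdots{?}z_n[z_n\sigma_1,z_n\sigma_2].x_1[x_2].({!}x_1(x'\sigma_1).D\sigma_1\parallel{!}x_2(x'\sigma_2).D\sigma_2)$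 if $\sigma_1,\sigma_2$ are name substitutions with $\mathrm{fn}(D\sigma_1)\cap\mathrm{fn}(D\sigma_2)=\emptyset$ and $\mathrm{fn}(D)\setminus\{x'\}=\{z_1,\ldots,z_n\}$ (in the last two the target has the same types as the source, except $x:1$ in place of $x:{!}A$, resp. $x_1:{!}A\otimes{!}A$ in place of $x:{!}A$); $x\leftrightarrow y\xrightarrow{x\leftrightarrow y}\mathbf 0$ and $x\leftrightarrow y\xrightarrow{y\leftrightarrow x}\mathbf 0$. ($\alpha$) a derivation of $\vdash P::\mathcal G$ has every transition of any derivation of $\vdash Q::\mathcal G$ with $P=_\alpha Q$. (Par) if $D\xrightarrow{l}D'$ and $\mathrm{bn}(l)\cap\mathrm{fn}(E)=\emptyset$ then $D\parallel E\xrightarrow{l}D'\parallel E$; symmetrically on the right. (Syn) if $D\xrightarrow{l}D'$, $E\xrightarrow{l'}E'$, $l,l'\in$ Act, $\mathrm{bn}(l)\cap\mathrm{bn}(l')=\emptyset$ then $D\parallel E\xrightarrow{l\parallel l'}D'\parallel E'$. (Res) if $D\xrightarrow{l}D'$ and $x,y\notin\mathrm{cn}(l)$ then $(\nu xy)D\xrightarrow{l}(\nu xy)D'$, where $D$ has hyperenvironment $\mathcal G\parallel\Gamma,x:A\parallel\Delta,y:A^\perp$ and $D'$ has $\mathcal G'\parallel\Gamma',x:A\parallel\Delta',y:A^\perp$. (Communication) $(\nu xy)D\xrightarrow{\tau}R$ whenever $D\xrightarrow{m}D'$, $D$ has hyperenvironment $\mathcal G\parallel\Gamma,x:C\parallel\Delta,y:C^\perp$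 and one of: $m=x[]\parallel y()$, $C=1$, $\Gamma$ empty, $D'$ has $\mathcal G\parallel\Delta$, $R=D'$; $m=x[x']\parallel y(y')$, $C=A\otimes B$, $\Gamma=\Gamma_1,\Gamma_2$, $D'$ has $\mathcal G\parallel\Gamma_1,x:B\parallel\Gamma_2,x':A\parallel\Delta,y:B^\perp,y':A^\perp$, $R=(\nu xy)(\nu x'y')D'$; $m=x[\mathsf{inl}]\parallel y(\mathsf{inl})$ (resp. $\mathsf{inr}$), $C=A_1\oplus A_2$, $D'$ has $\mathcal G\parallel\Gamma,x:A_i\parallel\Delta,y:A_i^\perp$ with $i=1$ (resp. $2$), $R=(\nu xy)D'$; $m=x[A]\parallel y(A)$, $C=\exists X.B$, $D'$ has $\mathcal G\parallel\Gamma,x:B\{A/X\}\parallel\Delta,y:B^\perp\{A/X\}$, $R=(\nu xy)D'$; $m={?}x[x']\parallel{!}y(y')$, $C={?}A$, $D'$ has $\mathcal G\parallel\Gamma,x':A\parallel\Delta,y':A^\perp$, $R=(\nu x'y')D'$; $m={?}x[x_1,x_2]\parallel{!}y(y_1,y_2)$, $C={?}A$, $\Delta={?}\Delta'$, $D'$ has $\mathcal G\parallel\Gamma,x_1:{?}A\wp{?}A\parallel\Delta,y_1:{!}A^\perp\otimes{!}A^\perp$, $R=(\nu x_1y_1)D'$; $m={?}x[]\parallel{!}y()$, $C={?}A$, $\Delta={?}\Delta'$, $D'$ has $\mathcal G\parallel\Gamma,x:\bot\parallel\Delta,y:1$, $R=(\nu xy)D'$. (Link) if $D\xrightarrow{z\leftrightarrow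 y}D'$ with $z\notin\{x,y\}$, $D$ having hyperenvironment $\mathcal G\parallel z:A^\perp,y:A\parallel\Gamma,x:A^\perp$ and $D'$ having $\mathcal G\parallel\Gamma,x:A^\perp$, then $(\nu xy)D\xrightarrow{\tau}D'\{z/x\}$.
   Formalization: Adds the hypothesis that the bound names of l₁ ∥ l₂ are not free in D (usual variable convention); without it the claim fails, e.g. D = ?x[y].y[].0 ∥ y[].0 performs ?x[y] ∥ y[] but cannot perform ?x[y] alone. -}

module Defs where

open import Data.Empty using (⊥)
open import Data.Fin using (Fin; zero; suc)
open import Data.List using (List; _∷_; _++_; map; concat; filter) renaming ([] to ∅)
open import Data.List.Membership.Propositional using (_∈_; _∉_)
open import Data.List.Relation.Binary.BagAndSetEquality using (_∼[_]_; set)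
open import Data.List.Relation.Binary.Disjoint.Propositional using (Disjoint)
open import Data.List.Relation.Binary.Permutation.Homogeneous using (Permutation)
open import Data.List.Relation.Binary.Permutation.Propositional using (_↭_)
open import Data.List.Relation.Unary.Unique.Propositional using (Unique)
open import Data.Nat using (ℕ; suc)
open import Data.Product using (_×_; ∃; ∃-syntax; proj₁) renaming (_,_ to infix 6 _⦂_)
open import Data.Sum using (_⊎_)
open import Data.Unit using (⊤)
open import Function using (id)
open import Relation.Binary.Definitions using (DecidableEquality)
open import Relation.Binary.PropositionalEquality using (_≡_; _≢_)
open import Relation.Nullary using (¬?; does)
open import Data.Bool using (if_then_else_)

-- An infinite set with decidable equality.
record Names : Set₁ where
  field
    Name  : Set
    _≟_   : DecidableEquality Name
    fresh : (xs : List Name) → ∃[ x ] x ∉ xs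

module πLL (𝒩 : Names) where

  open Names 𝒩

  infixr 8 _⊗_ _⅋_ _⊕_ _&_
  infixr 9 ∃ᵗ_ ∀ᵗ_ ?ᵗ_ !ᵗ_
  infix  10 _[_/X]
  infixl 5 _,_
  infixl 4 _∥ᴴ_
  infix  3 _≋_ _≐_
  infix  2 ⊢_∶∶_ _─⟨_⟩→_
  infix  3 _=α_
  infixl 5 _-_

  ----------------------------------------------------------------------
  -- Types

  -- Type variables are de Bruijn indices: `Ty n` has its free variables
  -- among n, and ∃ᵗ/∀ᵗ bind index zero.  Hence types, and the binder
  -- x(X).P of processes, are automatically taken up to renaming of X.
  data Ty (n : ℕ) : Set where
    _⊗_ _⅋_ _⊕_ _&_ : Ty n → Ty n → Ty n
    𝟏 ⊥ᵗ            : Ty n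
    var var⊥        : Fin n → Ty n
    ∃ᵗ_ ∀ᵗ_         : Ty (suc n) → Ty n
    ?ᵗ_ !ᵗ_         : Ty n → Ty n

  dual : ∀ {n} → Ty n → Ty n
  dual (A ⊗ B)  = dual A ⅋ dual B
  dual (A ⅋ B)  = dual A ⊗ dual B
  dual (A ⊕ B)  = dual A & dual B
  dual (A & B)  = dual A ⊕ dual B
  dual 𝟏        = ⊥ᵗ
  dual ⊥ᵗ       = 𝟏
  dual (var i)  = var⊥ i
  dual (var⊥ i) = var i
  dual (∃ᵗ A)   = ∀ᵗ dual A
  dual (∀ᵗ A)   = ∃ᵗ dual A
  dual (?ᵗ A)   = !ᵗ dual A
  dual (!ᵗ A)   = ?ᵗ dual A

  liftᴿ : ∀ {n m} → (Fin n → Fin m) → Fin (suc n) → Fin (suc m)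
  liftᴿ ξ zero    = zero
  liftᴿ ξ (suc i) = suc (ξ i)

  ren : ∀ {n m} → (Fin n → Fin m) → Ty n → Ty m
  ren ξ (A ⊗ B)  = ren ξ A ⊗ ren ξ B
  ren ξ (A ⅋ B)  = ren ξ A ⅋ ren ξ B
  ren ξ (A ⊕ B)  = ren ξ A ⊕ ren ξ B
  ren ξ (A & B)  = ren ξ A & ren ξ B
  ren ξ 𝟏        = 𝟏
  ren ξ ⊥ᵗ       = ⊥ᵗ
  ren ξ (var i)  = var (ξ i)
  ren ξ (var⊥ i) = var⊥ (ξ i)
  ren ξ (∃ᵗ A)   = ∃ᵗ ren (liftᴿ ξ) A
  ren ξ (∀ᵗ A)   = ∀ᵗ ren (liftᴿ ξ) A
  ren ξ (?ᵗ A)   = ?ᵗ ren ξ A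
  ren ξ (!ᵗ A)   = !ᵗ ren ξ A

  lift : ∀ {n m} → (Fin n → Ty m) → Fin (suc n) → Ty (suc m)
  lift θ zero    = var zero
  lift θ (suc i) = ren suc (θ i)

  sub : ∀ {n m} → (Fin n → Ty m) → Ty n → Ty m
  sub θ (A ⊗ B)  = sub θ A ⊗ sub θ B
  sub θ (A ⅋ B)  = sub θ A ⅋ sub θ B
  sub θ (A ⊕ B)  = sub θ A ⊕ sub θ B
  sub θ (A & B)  = sub θ A & sub θ B
  sub θ 𝟏        = 𝟏
  sub θ ⊥ᵗ       = ⊥ᵗ
  sub θ (var i)  = θ i
  sub θ (var⊥ i) = dual (θ i)
  sub θ (∃ᵗ A)   = ∃ᵗ sub (lift θ) A
  sub θ (∀ᵗ A)   = ∀ᵗ sub (lift θ) A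
  sub θ (?ᵗ A)   = ?ᵗ sub θ A
  sub θ (!ᵗ A)   = !ᵗ sub θ A

  instᵗ : ∀ {n} → Ty n → Fin (suc n) → Ty n
  instᵗ A zero    = A
  instᵗ A (suc i) = var i

  _[_/X] : ∀ {n} → Ty (suc n) → Ty n → Ty n
  B [ A /X] = sub (instᵗ A) B

  ----------------------------------------------------------------------
  -- Processes

  infixr 7 _[_]∙_ _⦅_⦆∙_ _[]∙_ _⦅⦆∙_ _[inl]∙_ _[inr]∙_ _[_]ᵗ∙_ _⦅X⦆∙_
           !_⦅_⦆∙_ ¿_[_]∙_ ¿_[_∣_]∙_ ¿_[]∙_ ⦅ν_∣_⦆_
  infix  7 _▷⟨_∣_⟩
  infix  6 _↔_
  infixr 5 _∥_

  -- A lone ? is reserved by Agda, so client prefixes and labels are written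
  -- with ¿.  Separators inside brackets are ∣.
  data Proc (n : ℕ) : Set where
    _[_]∙_          : Name → Name → Proc n → Proc n
    _⦅_⦆∙_          : Name → Name → Proc n → Proc n
    _[]∙_ _⦅⦆∙_     : Name → Proc n → Proc n
    _[inl]∙_        : Name → Proc n → Proc n
    _[inr]∙_        : Name → Proc n → Proc n
    _▷⟨_∣_⟩         : Name → Proc n → Proc n → Proc n
    _[_]ᵗ∙_         : Name → Ty n → Proc n → Proc n
    _⦅X⦆∙_          : Name → Proc (suc n) → Proc n
    !_⦅_⦆∙_         : Name → Name → Proc n → Proc n
    ¿_[_]∙_         : Name → Name → Proc n → Proc n
    ¿_[_∣_]∙_       : Name → Name → Name → Proc n → Proc n
    ¿_[]∙_          : Name → Proc n → Proc n
    ⦅ν_∣_⦆_         : Name → Name → Proc n → Proc n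
    _∥_             : Proc n → Proc n → Proc n
    𝟎               : Proc n
    _↔_             : Name → Name → Proc n

  _-_ : List Name → Name → List Name
  xs - y = filter (λ x → ¬? (x ≟ y)) xs

  fn : ∀ {n} → Proc n → List Name
  fn (x [ y ]∙ P)          = x ∷ (fn P - y)
  fn (x ⦅ y ⦆∙ P)          = x ∷ (fn P - y)
  fn (x []∙ P)             = x ∷ fn P
  fn (x ⦅⦆∙ P)             = x ∷ fn P
  fn (x [inl]∙ P)          = x ∷ fn P
  fn (x [inr]∙ P)          = x ∷ fn P
  fn (x ▷⟨ P ∣ Q ⟩)        = x ∷ (fn P ++ fn Q)
  fn (x [ A ]ᵗ∙ P)         = x ∷ fn P
  fn (x ⦅X⦆∙ P)            = x ∷ fn P
  fn (! x ⦅ y ⦆∙ P)        = x ∷ (fn P - y)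
  fn (¿ x [ y ]∙ P)        = x ∷ (fn P - y)
  fn (¿ x [ x₁ ∣ x₂ ]∙ P)  = x ∷ (fn P - x₁ - x₂)
  fn (¿ x []∙ P)           = x ∷ fn P
  fn (⦅ν x ∣ y ⦆ P)        = fn P - x - y
  fn (P ∥ Q)               = fn P ++ fn Q
  fn 𝟎                     = ∅
  fn (x ↔ y)               = x ∷ y ∷ ∅

  -- A list of pairs y ⦂ y′ records the binders crossed so far, innermost
  -- first, on the two sides of a comparison.  `Match σ ρ x x′` holds when
  -- x and x′ are bound by corresponding binders, or x and x′ are both not
  -- bound and x′ ≡ σ x (so that σ x is never captured).
  Match : (σ : Name → Name) → List (Name × Name) → Name → Name → Set
  Match σ ∅              x x′ = x′ ≡ σ x
  Match σ (y ⦂ y′ ∷ ρ)   x x′ = (x ≡ y × x′ ≡ y′) ⊎ (x ≢ y × x′ ≢ y′ × Match σ ρ x x′)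

  -- α-equivalence relative to a list of corresponding binders.  The second
  -- alternative for ν identifies (νxy)P with (νyx)P.
  Alpha : ∀ {n} → List (Name × Name) → Proc n → Proc n → Set
  Alpha ρ (x [ y ]∙ P) (x′ [ y′ ]∙ P′) = Match id ρ x x′ × Alpha (y ⦂ y′ ∷ ρ) P P′
  Alpha ρ (x ⦅ y ⦆∙ P) (x′ ⦅ y′ ⦆∙ P′) = Match id ρ x x′ × Alpha (y ⦂ y′ ∷ ρ) P P′
  Alpha ρ (x []∙ P) (x′ []∙ P′) = Match id ρ x x′ × Alpha ρ P P′
  Alpha ρ (x ⦅⦆∙ P) (x′ ⦅⦆∙ P′) = Match id ρ x x′ × Alpha ρ P P′
  Alpha ρ (x [inl]∙ P) (x′ [inl]∙ P′) = Match id ρ x x′ × Alpha ρ P P′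
  Alpha ρ (x [inr]∙ P) (x′ [inr]∙ P′) = Match id ρ x x′ × Alpha ρ P P′
  Alpha ρ (x ▷⟨ P ∣ Q ⟩) (x′ ▷⟨ P′ ∣ Q′ ⟩) = Match id ρ x x′ × Alpha ρ P P′ × Alpha ρ Q Q′
  Alpha ρ (x [ A ]ᵗ∙ P) (x′ [ A′ ]ᵗ∙ P′) = Match id ρ x x′ × A′ ≡ A × Alpha ρ P P′
  Alpha ρ (x ⦅X⦆∙ P) (x′ ⦅X⦆∙ P′) = Match id ρ x x′ × Alpha ρ P P′
  Alpha ρ (! x ⦅ y ⦆∙ P) (! x′ ⦅ y′ ⦆∙ P′) = Match id ρ x x′ × Alpha (y ⦂ y′ ∷ ρ) P P′
  Alpha ρ (¿ x [ y ]∙ P) (¿ x′ [ y′ ]∙ P′) = Match id ρ x x′ × Alpha (y ⦂ y′ ∷ ρ) P P′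
  Alpha ρ (¿ x [ x₁ ∣ x₂ ]∙ P) (¿ x′ [ x₁′ ∣ x₂′ ]∙ P′) =
    Match id ρ x x′ × Alpha (x₂ ⦂ x₂′ ∷ x₁ ⦂ x₁′ ∷ ρ) P P′
  Alpha ρ (¿ x []∙ P) (¿ x′ []∙ P′) = Match id ρ x x′ × Alpha ρ P P′
  Alpha ρ (⦅ν x ∣ y ⦆ P) (⦅ν x′ ∣ y′ ⦆ P′) =
    Alpha (y ⦂ y′ ∷ x ⦂ x′ ∷ ρ) P P′ ⊎ Alpha (y ⦂ x′ ∷ x ⦂ y′ ∷ ρ) P P′
  Alpha ρ (P ∥ Q) (P′ ∥ Q′) = Alpha ρ P P′ × Alpha ρ Q Q′
  Alpha ρ 𝟎 𝟎 = ⊤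
  Alpha ρ (x ↔ y) (x′ ↔ y′) = Match id ρ x x′ × Match id ρ y y′
  Alpha ρ _ _ = ⊥

  _=α_ : ∀ {n} → Proc n → Proc n → Set
  P =α Q = Alpha ∅ P Q

  ----------------------------------------------------------------------
  -- Environments and hyperenvironments

  Env HEnv : ℕ → Set
  Env n  = List (Name × Ty n)
  HEnv n = List (Env n)

  _,_ : ∀ {n} → Env n → Name × Ty n → Env n
  Γ , xA = xA ∷ Γ

  _∥ᴴ_ : ∀ {n} → HEnv n → Env n → HEnv n
  G ∥ᴴ Γ = Γ ∷ G

  -- Equality of hyperenvironments: multisets of unordered lists.
  _≋_ : ∀ {n} → HEnv n → HEnv n → Set
  _≋_ = Permutation _↭_

  Distinct : ∀ {n} → HEnv n → Set
  Distinct G = Unique (map proj₁ (concat G))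

  _≐_ : ∀ {n} → HEnv n → HEnv n → Set
  K ≐ G = K ≋ G × Distinct K

  -- ?ᴱ Γ ranges over the environments all of whose types have the form ?ᵗ A.
  ?ᴱ_ : ∀ {n} → Env n → Env n
  ?ᴱ Γ = map (λ { (x ⦂ A) → x ⦂ ?ᵗ A }) Γ

  wk : ∀ {n} → Env n → Env (suc n)
  wk Γ = map (λ { (x ⦂ A) → x ⦂ ren suc A }) Γ

  ----------------------------------------------------------------------
  -- Typing derivations

  private variable
    n m               : ℕ
    x y z x′ y′       : Name
    x₁ x₂ y₁ y₂       : Name
    zs                : List Name
    A B C             : Ty n
    P P′ Q Q′ P₁ P₂   : Proc n
    Γ Γ′ Γ₁ Γ₂ Δ Δ′   : Env n
    G G′ H H′ H₁ H₂   : HEnv n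
    K K′ K₀ K₁ K₂ M   : HEnv n

  -- Every rule is stated up to ≋ on both sides, so that no exchange rule
  -- is needed and one process constructor corresponds to one rule.
  data ⊢_∶∶_ {n : ℕ} : Proc n → HEnv n → Set where
    ⊢ax   : K ≐ ∅ ∥ᴴ ∅ , x ⦂ dual A , y ⦂ A
          → ⊢ x ↔ y ∶∶ K
    ⊢cut  : H ≋ G ∥ᴴ Γ , x ⦂ A ∥ᴴ Δ , y ⦂ dual A
          → K ≐ G ∥ᴴ Γ ++ Δ
          → ⊢ P ∶∶ H → ⊢ ⦅ν x ∣ y ⦆ P ∶∶ K
    ⊢mix  : K ≐ G ++ H
          → ⊢ P ∶∶ G → ⊢ Q ∶∶ H → ⊢ P ∥ Q ∶∶ K
    ⊢mix₀ : K ≐ ∅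
          → ⊢ 𝟎 ∶∶ K
    ⊢⊗    : H ≋ ∅ ∥ᴴ Γ , y ⦂ A ∥ᴴ Δ , x ⦂ B
          → K ≐ ∅ ∥ᴴ (Γ ++ Δ) , x ⦂ A ⊗ B
          → ⊢ P ∶∶ H → ⊢ x [ y ]∙ P ∶∶ K
    ⊢1    : H ≋ ∅
          → K ≐ ∅ ∥ᴴ ∅ , x ⦂ 𝟏
          → ⊢ P ∶∶ H → ⊢ x []∙ P ∶∶ K
    ⊢⅋    : H ≋ ∅ ∥ᴴ Γ , y ⦂ A , x ⦂ B
          → K ≐ ∅ ∥ᴴ Γ , x ⦂ A ⅋ B
          → ⊢ P ∶∶ H → ⊢ x ⦅ y ⦆∙ P ∶∶ K
    ⊢⊥    : H ≋ ∅ ∥ᴴ Γ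
          → K ≐ ∅ ∥ᴴ Γ , x ⦂ ⊥ᵗ
          → ⊢ P ∶∶ H → ⊢ x ⦅⦆∙ P ∶∶ K
    ⊢⊕₁   : H ≋ ∅ ∥ᴴ Γ , x ⦂ A
          → K ≐ ∅ ∥ᴴ Γ , x ⦂ A ⊕ B
          → ⊢ P ∶∶ H → ⊢ x [inl]∙ P ∶∶ K
    ⊢⊕₂   : H ≋ ∅ ∥ᴴ Γ , x ⦂ B
          → K ≐ ∅ ∥ᴴ Γ , x ⦂ A ⊕ B
          → ⊢ P ∶∶ H → ⊢ x [inr]∙ P ∶∶ K
    ⊢&    : H₁ ≋ ∅ ∥ᴴ Γ , x ⦂ A
          → H₂ ≋ ∅ ∥ᴴ Γ , x ⦂ B
          → K ≐ ∅ ∥ᴴ Γ , x ⦂ A & B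
          → ⊢ P ∶∶ H₁ → ⊢ Q ∶∶ H₂ → ⊢ x ▷⟨ P ∣ Q ⟩ ∶∶ K
    ⊢!    : H ≋ ∅ ∥ᴴ ?ᴱ Γ , y ⦂ A
          → K ≐ ∅ ∥ᴴ ?ᴱ Γ , x ⦂ !ᵗ A
          → ⊢ P ∶∶ H → ⊢ ! x ⦅ y ⦆∙ P ∶∶ K
    ⊢?    : H ≋ ∅ ∥ᴴ Γ , y ⦂ A
          → K ≐ ∅ ∥ᴴ Γ , x ⦂ ?ᵗ A
          → ⊢ P ∶∶ H → ⊢ ¿ x [ y ]∙ P ∶∶ K
    ⊢W    : H ≋ ∅ ∥ᴴ Γ
          → K ≐ ∅ ∥ᴴ Γ , x ⦂ ?ᵗ A
          → ⊢ P ∶∶ H → ⊢ ¿ x []∙ P ∶∶ K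
    ⊢C    : H ≋ ∅ ∥ᴴ Γ , x₁ ⦂ ?ᵗ A , x₂ ⦂ ?ᵗ A
          → K ≐ ∅ ∥ᴴ Γ , x ⦂ ?ᵗ A
          → ⊢ P ∶∶ H → ⊢ ¿ x [ x₁ ∣ x₂ ]∙ P ∶∶ K
    ⊢∃    : H ≋ ∅ ∥ᴴ Γ , x ⦂ B [ A /X]
          → K ≐ ∅ ∥ᴴ Γ , x ⦂ ∃ᵗ B
          → ⊢ P ∶∶ H → ⊢ x [ A ]ᵗ∙ P ∶∶ K
    ⊢∀    : H ≋ ∅ ∥ᴴ wk Γ , x ⦂ B
          → K ≐ ∅ ∥ᴴ Γ , x ⦂ ∀ᵗ B
          → ⊢ P ∶∶ H → ⊢ x ⦅X⦆∙ P ∶∶ K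

  proc : ∀ {n} {P : Proc n} {G} → ⊢ P ∶∶ G → Proc n
  proc {P = P} _ = P

  -- `Subst σ θ ρ D E`: the derivation E is D under the capture-avoiding
  -- name substitution σ and type substitution θ (for any choice of bound
  -- names), ρ listing the corresponding binders.  The types not determined
  -- by E's own subderivations are those of D under θ.
  Subst : (σ : Name → Name) → (Fin n → Ty m) → List (Name × Name)
        → {P : Proc n} {G : HEnv n} {Q : Proc m} {H : HEnv m}
        → ⊢ P ∶∶ G → ⊢ Q ∶∶ H → Set
  Subst σ θ ρ (⊢ax {x = x} {A = A} {y = y} _) (⊢ax {x = x′} {A = A′} {y = y′} _) =
    A′ ≡ sub θ A × Match σ ρ x x′ × Match σ ρ y y′
  Subst σ θ ρ (⊢cut {x = x} {A = A} {y = y} _ _ D) (⊢cut {x = x′} {A = A′} {y = y′} _ _ E) =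
    A′ ≡ sub θ A × Subst σ θ (y ⦂ y′ ∷ x ⦂ x′ ∷ ρ) D E
  Subst σ θ ρ (⊢mix _ D₁ D₂) (⊢mix _ E₁ E₂) = Subst σ θ ρ D₁ E₁ × Subst σ θ ρ D₂ E₂
  Subst σ θ ρ (⊢mix₀ _) (⊢mix₀ _) = ⊤
  Subst σ θ ρ (⊢⊗ {y = y} {A = A} {x = x} {B = B} _ _ D) (⊢⊗ {y = y′} {A = A′} {x = x′} {B = B′} _ _ E) =
    A′ ≡ sub θ A × B′ ≡ sub θ B × Match σ ρ x x′ × Subst σ θ (y ⦂ y′ ∷ ρ) D E
  Subst σ θ ρ (⊢1 {x = x} _ _ D) (⊢1 {x = x′} _ _ E) = Match σ ρ x x′ × Subst σ θ ρ D E
  Subst σ θ ρ (⊢⅋ {y = y} {A = A} {x = x} {B = B} _ _ D) (⊢⅋ {y = y′} {A = A′} {x = x′} {B = B′} _ _ E) =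
    A′ ≡ sub θ A × B′ ≡ sub θ B × Match σ ρ x x′ × Subst σ θ (y ⦂ y′ ∷ ρ) D E
  Subst σ θ ρ (⊢⊥ {x = x} _ _ D) (⊢⊥ {x = x′} _ _ E) = Match σ ρ x x′ × Subst σ θ ρ D E
  Subst σ θ ρ (⊢⊕₁ {x = x} {A = A} {B = B} _ _ D) (⊢⊕₁ {x = x′} {A = A′} {B = B′} _ _ E) =
    A′ ≡ sub θ A × B′ ≡ sub θ B × Match σ ρ x x′ × Subst σ θ ρ D E
  Subst σ θ ρ (⊢⊕₂ {x = x} {B = B} {A = A} _ _ D) (⊢⊕₂ {x = x′} {B = B′} {A = A′} _ _ E) =
    A′ ≡ sub θ A × B′ ≡ sub θ B × Match σ ρ x x′ × Subst σ θ ρ D E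
  Subst σ θ ρ (⊢& {x = x} {A = A} {B = B} _ _ _ D₁ D₂) (⊢& {x = x′} {A = A′} {B = B′} _ _ _ E₁ E₂) =
    A′ ≡ sub θ A × B′ ≡ sub θ B × Match σ ρ x x′ × Subst σ θ ρ D₁ E₁ × Subst σ θ ρ D₂ E₂
  Subst σ θ ρ (⊢! {y = y} {A = A} {x = x} _ _ D) (⊢! {y = y′} {A = A′} {x = x′} _ _ E) =
    A′ ≡ sub θ A × Match σ ρ x x′ × Subst σ θ (y ⦂ y′ ∷ ρ) D E
  Subst σ θ ρ (⊢? {y = y} {A = A} {x = x} _ _ D) (⊢? {y = y′} {A = A′} {x = x′} _ _ E) =
    A′ ≡ sub θ A × Match σ ρ x x′ × Subst σ θ (y ⦂ y′ ∷ ρ) D E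
  Subst σ θ ρ (⊢W {x = x} {A = A} _ _ D) (⊢W {x = x′} {A = A′} _ _ E) =
    A′ ≡ sub θ A × Match σ ρ x x′ × Subst σ θ ρ D E
  Subst σ θ ρ (⊢C {x₁ = x₁} {A = A} {x₂ = x₂} {x = x} _ _ D)
              (⊢C {x₁ = x₁′} {A = A′} {x₂ = x₂′} {x = x′} _ _ E) =
    A′ ≡ sub θ A × Match σ ρ x x′ × Subst σ θ (x₂ ⦂ x₂′ ∷ x₁ ⦂ x₁′ ∷ ρ) D E
  Subst σ θ ρ (⊢∃ {x = x} {B = B} {A = A} _ _ D) (⊢∃ {x = x′} {B = B′} {A = A′} _ _ E) =
    A′ ≡ sub θ A × B′ ≡ sub (lift θ) B × Match σ ρ x x′ × Subst σ θ ρ D E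
  Subst σ θ ρ (⊢∀ {x = x} {B = B} _ _ D) (⊢∀ {x = x′} {B = B′} _ _ E) =
    B′ ≡ sub (lift θ) B × Match σ ρ x x′ × Subst σ (lift θ) ρ D E
  Subst σ θ ρ _ _ = ⊥

  infix 3 _≈_⟦_⟧ⁿ _≈_⟦_/X⟧

  _≈_⟦_⟧ⁿ : {P Q : Proc n} {G H : HEnv n}
          → ⊢ Q ∶∶ H → ⊢ P ∶∶ G → (Name → Name) → Set
  E ≈ D ⟦ σ ⟧ⁿ = Subst σ var ∅ D E

  _≈_⟦_/X⟧ : {P : Proc (suc n)} {G : HEnv (suc n)} {Q : Proc n} {H : HEnv n}
           → ⊢ Q ∶∶ H → ⊢ P ∶∶ G → Ty n → Set
  E ≈ D ⟦ A /X⟧ = Subst id (instᵗ A) ∅ D E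

  _for_ : Name → Name → Name → Name
  (z for x) w = if does (w ≟ x) then z else w

  ----------------------------------------------------------------------
  -- Labels

  infix 7 _[] _⦅⦆ _[_] _⦅_⦆ _[inl] _⦅inl⦆ _[inr] _⦅inr⦆ ¿_[_] !_⦅_⦆
          ¿_[_∣_] !_⦅_∣_⦆ ¿_[] !_⦅⦆ _[_]ᵗ _⦅_⦆ᵗ

  data Act (n : ℕ) : Set where
    _[] _⦅⦆                     : Name → Act n
    _[_] _⦅_⦆                   : Name → Name → Act n
    _[inl] _⦅inl⦆ _[inr] _⦅inr⦆ : Name → Act n
    ¿_[_] !_⦅_⦆                 : Name → Name → Act n
    ¿_[_∣_] !_⦅_∣_⦆             : Name → Name → Name → Act n
    ¿_[] !_⦅⦆                   : Name → Act n
    _[_]ᵗ _⦅_⦆ᵗ                 : Name → Ty n → Act n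

  -- Pairs l ∥ l′ are unordered because transitions are closed under
  -- exchanging l and l′ (constructor `exch` below).
  data Label (n : ℕ) : Set where
    τ   : Label n
    _↔_ : Name → Name → Label n
    act : Act n → Label n
    _∥_ : Act n → Act n → Label n

  subj : Act n → Name
  subj (x [])            = x
  subj (x ⦅⦆)            = x
  subj (x [ y ])         = x
  subj (x ⦅ y ⦆)         = x
  subj (x [inl])         = x
  subj (x ⦅inl⦆)         = x
  subj (x [inr])         = x
  subj (x ⦅inr⦆)         = x
  subj (¿ x [ y ])       = x
  subj (! x ⦅ y ⦆)       = x
  subj (¿ x [ x₁ ∣ x₂ ]) = x
  subj (! x ⦅ x₁ ∣ x₂ ⦆) = x
  subj (¿ x [])          = x
  subj (! x ⦅⦆)          = x
  subj (x [ A ]ᵗ)        = x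
  subj (x ⦅ A ⦆ᵗ)        = x

  bnᴬ : Act n → List Name
  bnᴬ (x [ y ])         = y ∷ ∅
  bnᴬ (x ⦅ y ⦆)         = y ∷ ∅
  bnᴬ (¿ x [ y ])       = y ∷ ∅
  bnᴬ (! x ⦅ y ⦆)       = y ∷ ∅
  bnᴬ (¿ x [ x₁ ∣ x₂ ]) = x₁ ∷ x₂ ∷ ∅
  bnᴬ (! x ⦅ x₁ ∣ x₂ ⦆) = x₁ ∷ x₂ ∷ ∅
  bnᴬ _                 = ∅

  fnᴸ bnᴸ cn : Label n → List Name
  fnᴸ τ        = ∅
  fnᴸ (x ↔ y)  = x ∷ y ∷ ∅
  fnᴸ (act l)  = subj l ∷ ∅
  fnᴸ (l ∥ l′) = subj l ∷ subj l′ ∷ ∅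

  bnᴸ τ        = ∅
  bnᴸ (x ↔ y)  = ∅
  bnᴸ (act l)  = bnᴬ l
  bnᴸ (l ∥ l′) = bnᴬ l ++ bnᴬ l′

  cn l = fnᴸ l ++ bnᴸ l

  ----------------------------------------------------------------------
  -- Transitions

  private variable
    D D′ D₀ E E′ E₁ E₂ T : ⊢ P ∶∶ G
    σ σ₁ σ₂              : Name → Name
    l l′                 : Act n
    ℓ                    : Label n

  -- T is ?z₁[].⋯?zₖ[].D
  data Weakenings {n} {P : Proc n} {G : HEnv n} (D : ⊢ P ∶∶ G)
       : List Name → {Q : Proc n} {H : HEnv n} → ⊢ Q ∶∶ H → Set where
    done : Weakenings D ∅ D
    step : Weakenings D zs T
         → (h : H ≋ ∅ ∥ᴴ Γ) (k : K ≐ ∅ ∥ᴴ Γ , z ⦂ ?ᵗ A)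
         → Weakenings D (z ∷ zs) (⊢W h k T)

  -- T is ?z₁[z₁σ₁,z₁σ₂].⋯?zₖ[zₖσ₁,zₖσ₂].D
  data Contractions (σ₁ σ₂ : Name → Name) {n} {P : Proc n} {G : HEnv n} (D : ⊢ P ∶∶ G)
       : List Name → {Q : Proc n} {H : HEnv n} → ⊢ Q ∶∶ H → Set where
    done : Contractions σ₁ σ₂ D ∅ D
    step : Contractions σ₁ σ₂ D zs T
         → (h : H ≋ ∅ ∥ᴴ Γ , σ₁ z ⦂ ?ᵗ A , σ₂ z ⦂ ?ᵗ A) (k : K ≐ ∅ ∥ᴴ Γ , z ⦂ ?ᵗ A)
         → Contractions σ₁ σ₂ D (z ∷ zs) (⊢C h k T)

  -- In `alpha`, environments being unordered, the two derivations may list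
  -- the same hyperenvironment differently.
  data _─⟨_⟩→_ : {P P′ : Proc n} {G G′ : HEnv n}
               → ⊢ P ∶∶ G → Label n → ⊢ P′ ∶∶ G′ → Set where

    ⊗→ : (h : H ≋ ∅ ∥ᴴ Γ , y ⦂ A ∥ᴴ Δ , x ⦂ B) (k : K ≐ ∅ ∥ᴴ (Γ ++ Δ) , x ⦂ A ⊗ B)
       → ⊢⊗ h k D ─⟨ act (x [ y ]) ⟩→ D
    ⅋→ : (h : H ≋ ∅ ∥ᴴ Γ , y ⦂ A , x ⦂ B) (k : K ≐ ∅ ∥ᴴ Γ , x ⦂ A ⅋ B)
       → ⊢⅋ h k D ─⟨ act (x ⦅ y ⦆) ⟩→ D
    1→ : (h : H ≋ ∅) (k : K ≐ ∅ ∥ᴴ ∅ , x ⦂ 𝟏)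
       → ⊢1 h k D ─⟨ act (x []) ⟩→ D
    ⊥→ : (h : H ≋ ∅ ∥ᴴ Γ) (k : K ≐ ∅ ∥ᴴ Γ , x ⦂ ⊥ᵗ)
       → ⊢⊥ h k D ─⟨ act (x ⦅⦆) ⟩→ D
    ⊕₁→ : (h : H ≋ ∅ ∥ᴴ Γ , x ⦂ A) (k : K ≐ ∅ ∥ᴴ Γ , x ⦂ A ⊕ B)
        → ⊢⊕₁ h k D ─⟨ act (x [inl]) ⟩→ D
    ⊕₂→ : (h : H ≋ ∅ ∥ᴴ Γ , x ⦂ B) (k : K ≐ ∅ ∥ᴴ Γ , x ⦂ A ⊕ B)
        → ⊢⊕₂ h k D ─⟨ act (x [inr]) ⟩→ D
    ∃→ : (h : H ≋ ∅ ∥ᴴ Γ , x ⦂ B [ A /X]) (k : K ≐ ∅ ∥ᴴ Γ , x ⦂ ∃ᵗ B)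
       → ⊢∃ {B = B} {A = A} h k D ─⟨ act (x [ A ]ᵗ) ⟩→ D
    ?→ : (h : H ≋ ∅ ∥ᴴ Γ , y ⦂ A) (k : K ≐ ∅ ∥ᴴ Γ , x ⦂ ?ᵗ A)
       → ⊢? h k D ─⟨ act (¿ x [ y ]) ⟩→ D
    !→ : (h : H ≋ ∅ ∥ᴴ ?ᴱ Γ , y ⦂ A) (k : K ≐ ∅ ∥ᴴ ?ᴱ Γ , x ⦂ !ᵗ A)
       → ⊢! {Γ = Γ} h k D ─⟨ act (! x ⦅ y ⦆) ⟩→ D

    &₁→ : (h₁ : H₁ ≋ ∅ ∥ᴴ Γ , x ⦂ A) (h₂ : H₂ ≋ ∅ ∥ᴴ Γ , x ⦂ B) (k : K ≐ ∅ ∥ᴴ Γ , x ⦂ A & B)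
        → ⊢& h₁ h₂ k D E ─⟨ act (x ⦅inl⦆) ⟩→ D
    &₂→ : (h₁ : H₁ ≋ ∅ ∥ᴴ Γ , x ⦂ A) (h₂ : H₂ ≋ ∅ ∥ᴴ Γ , x ⦂ B) (k : K ≐ ∅ ∥ᴴ Γ , x ⦂ A & B)
        → ⊢& h₁ h₂ k D E ─⟨ act (x ⦅inr⦆) ⟩→ E

    ∀→ : {D : ⊢ P ∶∶ H} {E : ⊢ Q ∶∶ K′}
         (h : H ≋ ∅ ∥ᴴ wk Γ , x ⦂ B) (k : K ≐ ∅ ∥ᴴ Γ , x ⦂ ∀ᵗ B)
       → E ≈ D ⟦ A /X⟧ → K′ ≋ ∅ ∥ᴴ Γ , x ⦂ B [ A /X]
       → ⊢∀ {Γ = Γ} h k D ─⟨ act (x ⦅ A ⦆ᵗ) ⟩→ E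

    W→ : (h : H ≋ ∅ ∥ᴴ Γ) (k : K ≐ ∅ ∥ᴴ Γ , x ⦂ ?ᵗ A) (k′ : K′ ≐ ∅ ∥ᴴ Γ , x ⦂ ⊥ᵗ)
       → ⊢W h k D ─⟨ act (¿ x []) ⟩→ ⊢⊥ h k′ D
    C→ : (h : H ≋ ∅ ∥ᴴ Γ , x₁ ⦂ ?ᵗ A , x₂ ⦂ ?ᵗ A) (k : K ≐ ∅ ∥ᴴ Γ , x ⦂ ?ᵗ A)
         (h′ : H ≋ ∅ ∥ᴴ Γ , x₂ ⦂ ?ᵗ A , x₁ ⦂ ?ᵗ A) (k′ : K′ ≐ ∅ ∥ᴴ Γ , x₁ ⦂ ?ᵗ A ⅋ ?ᵗ A)
       → ⊢C h k D ─⟨ act (¿ x [ x₁ ∣ x₂ ]) ⟩→ ⊢⅋ h′ k′ D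

    !W→ : {D : ⊢ P ∶∶ H} {T : ⊢ Q ∶∶ K′}
          (h : H ≋ ∅ ∥ᴴ ?ᴱ Γ , x′ ⦂ A) (k : K ≐ ∅ ∥ᴴ ?ᴱ Γ , x ⦂ !ᵗ A)
        → Unique zs → zs ∼[ set ] fn (proc D) - x′
        → (m₀ : M ≐ ∅) (h₁ : M ≋ ∅) (k₁ : K₁ ≐ ∅ ∥ᴴ ∅ , x ⦂ 𝟏)
        → Weakenings (⊢1 h₁ k₁ (⊢mix₀ m₀)) zs T
        → K′ ≋ ∅ ∥ᴴ ?ᴱ Γ , x ⦂ 𝟏
        → ⊢! {Γ = Γ} h k D ─⟨ act (! x ⦅⦆) ⟩→ T

    !C→ : {D : ⊢ P ∶∶ H} {E₁ : ⊢ P₁ ∶∶ H₁} {E₂ : ⊢ P₂ ∶∶ H₂} {T : ⊢ Q ∶∶ K′}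
          (h : H ≋ ∅ ∥ᴴ ?ᴱ Γ , x′ ⦂ A) (k : K ≐ ∅ ∥ᴴ ?ᴱ Γ , x ⦂ !ᵗ A)
        → Unique zs → zs ∼[ set ] fn (proc D) - x′
        → E₁ ≈ D ⟦ σ₁ ⟧ⁿ → E₂ ≈ D ⟦ σ₂ ⟧ⁿ → Disjoint (fn (proc E₁)) (fn (proc E₂))
        → (h₁ : H₁ ≋ ∅ ∥ᴴ ?ᴱ Γ₁ , σ₁ x′ ⦂ A) (k₁ : K₁ ≐ ∅ ∥ᴴ ?ᴱ Γ₁ , x₁ ⦂ !ᵗ A)
          (h₂ : H₂ ≋ ∅ ∥ᴴ ?ᴱ Γ₂ , σ₂ x′ ⦂ A) (k₂ : K₂ ≐ ∅ ∥ᴴ ?ᴱ Γ₂ , x₂ ⦂ !ᵗ A)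
          (m₀ : M ≐ K₁ ++ K₂)
          (h₀ : M ≋ ∅ ∥ᴴ ?ᴱ Γ₂ , x₂ ⦂ !ᵗ A ∥ᴴ ?ᴱ Γ₁ , x₁ ⦂ !ᵗ A)
          (k₀ : K₀ ≐ ∅ ∥ᴴ (?ᴱ Γ₂ ++ ?ᴱ Γ₁) , x₁ ⦂ !ᵗ A ⊗ !ᵗ A)
        → Contractions σ₁ σ₂ (⊢⊗ h₀ k₀ (⊢mix m₀ (⊢! {Γ = Γ₁} h₁ k₁ E₁) (⊢! {Γ = Γ₂} h₂ k₂ E₂))) zs T
        → K′ ≋ ∅ ∥ᴴ ?ᴱ Γ , x₁ ⦂ !ᵗ A ⊗ !ᵗ A
        → ⊢! {Γ = Γ} h k D ─⟨ act (! x ⦅ x₁ ∣ x₂ ⦆) ⟩→ T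

    ax→ : (k : K ≐ ∅ ∥ᴴ ∅ , x ⦂ dual A , y ⦂ A) (k′ : K′ ≐ ∅)
        → ⊢ax k ─⟨ x ↔ y ⟩→ ⊢mix₀ k′
    ax←  : (k : K ≐ ∅ ∥ᴴ ∅ , x ⦂ dual A , y ⦂ A) (k′ : K′ ≐ ∅)
        → ⊢ax k ─⟨ y ↔ x ⟩→ ⊢mix₀ k′

    alpha : {D : ⊢ P ∶∶ G} {E : ⊢ Q ∶∶ H}
          → P =α Q → G ≋ H → E ─⟨ ℓ ⟩→ D′
          → D ─⟨ ℓ ⟩→ D′

    exch : D ─⟨ l ∥ l′ ⟩→ D′ → D ─⟨ l′ ∥ l ⟩→ D′

    parₗ : {D : ⊢ P ∶∶ G} {D′ : ⊢ P′ ∶∶ G′} {E : ⊢ Q ∶∶ H}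
           (k : K ≐ G ++ H) (k′ : K′ ≐ G′ ++ H)
         → D ─⟨ ℓ ⟩→ D′ → Disjoint (bnᴸ ℓ) (fn (proc E))
         → ⊢mix k D E ─⟨ ℓ ⟩→ ⊢mix k′ D′ E
    parᵣ : {D : ⊢ P ∶∶ G} {E : ⊢ Q ∶∶ H} {E′ : ⊢ Q′ ∶∶ H′}
           (k : K ≐ G ++ H) (k′ : K′ ≐ G ++ H′)
         → E ─⟨ ℓ ⟩→ E′ → Disjoint (bnᴸ ℓ) (fn (proc D))
         → ⊢mix k D E ─⟨ ℓ ⟩→ ⊢mix k′ D E′
    syn : {D : ⊢ P ∶∶ G} {D′ : ⊢ P′ ∶∶ G′} {E : ⊢ Q ∶∶ H} {E′ : ⊢ Q′ ∶∶ H′}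
          (k : K ≐ G ++ H) (k′ : K′ ≐ G′ ++ H′)
        → D ─⟨ act l ⟩→ D′ → E ─⟨ act l′ ⟩→ E′ → Disjoint (bnᴬ l) (bnᴬ l′)
        → ⊢mix k D E ─⟨ l ∥ l′ ⟩→ ⊢mix k′ D′ E′

    res : (h  : H  ≋ G  ∥ᴴ Γ  , x ⦂ A ∥ᴴ Δ  , y ⦂ dual A) (k  : K  ≐ G  ∥ᴴ Γ  ++ Δ)
          (h′ : H′ ≋ G′ ∥ᴴ Γ′ , x ⦂ A ∥ᴴ Δ′ , y ⦂ dual A) (k′ : K′ ≐ G′ ∥ᴴ Γ′ ++ Δ′)
        → D ─⟨ ℓ ⟩→ D′ → x ∉ cn ℓ → y ∉ cn ℓ
        → ⊢cut h k D ─⟨ ℓ ⟩→ ⊢cut h′ k′ D′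

    com-1⊥ : {D : ⊢ P ∶∶ H} {D′ : ⊢ P′ ∶∶ H′}
             (h : H ≋ G ∥ᴴ ∅ , x ⦂ 𝟏 ∥ᴴ Δ , y ⦂ ⊥ᵗ) (k : K ≐ G ∥ᴴ ∅ ++ Δ)
           → D ─⟨ x [] ∥ y ⦅⦆ ⟩→ D′
           → H′ ≋ G ∥ᴴ Δ
           → ⊢cut {x = x} {A = 𝟏} {y = y} h k D ─⟨ τ ⟩→ D′
    com-⊗⅋ : (h : H ≋ G ∥ᴴ Γ , x ⦂ A ⊗ B ∥ᴴ Δ , y ⦂ dual A ⅋ dual B) (k : K ≐ G ∥ᴴ Γ ++ Δ)
           → D ─⟨ x [ x′ ] ∥ y ⦅ y′ ⦆ ⟩→ D′
           → Γ ↭ Γ₁ ++ Γ₂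
           → (h₁ : H′ ≋ G ∥ᴴ Γ₁ , x ⦂ B ∥ᴴ Γ₂ , x′ ⦂ A ∥ᴴ Δ , y ⦂ dual B , y′ ⦂ dual A)
             (k₁ : K₁ ≐ (G ∥ᴴ Γ₁ , x ⦂ B) ∥ᴴ Γ₂ ++ (Δ , y ⦂ dual B))
             (h₂ : K₁ ≋ G ∥ᴴ Γ₁ , x ⦂ B ∥ᴴ (Γ₂ ++ Δ) , y ⦂ dual B)
             (k₂ : K₂ ≐ G ∥ᴴ Γ₁ ++ (Γ₂ ++ Δ))
           → ⊢cut {A = A ⊗ B} h k D ─⟨ τ ⟩→ ⊢cut {A = B} h₂ k₂ (⊢cut {A = A} h₁ k₁ D′)
    com-⊕&₁ : (h : H ≋ G ∥ᴴ Γ , x ⦂ A ⊕ B ∥ᴴ Δ , y ⦂ dual A & dual B) (k : K ≐ G ∥ᴴ Γ ++ Δ)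
           → D ─⟨ x [inl] ∥ y ⦅inl⦆ ⟩→ D′
           → (h′ : H′ ≋ G ∥ᴴ Γ , x ⦂ A ∥ᴴ Δ , y ⦂ dual A) (k′ : K′ ≐ G ∥ᴴ Γ ++ Δ)
           → ⊢cut {A = A ⊕ B} h k D ─⟨ τ ⟩→ ⊢cut h′ k′ D′
    com-⊕&₂ : (h : H ≋ G ∥ᴴ Γ , x ⦂ A ⊕ B ∥ᴴ Δ , y ⦂ dual A & dual B) (k : K ≐ G ∥ᴴ Γ ++ Δ)
           → D ─⟨ x [inr] ∥ y ⦅inr⦆ ⟩→ D′
           → (h′ : H′ ≋ G ∥ᴴ Γ , x ⦂ B ∥ᴴ Δ , y ⦂ dual B) (k′ : K′ ≐ G ∥ᴴ Γ ++ Δ)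
           → ⊢cut {A = A ⊕ B} h k D ─⟨ τ ⟩→ ⊢cut h′ k′ D′
    com-∃∀ : (h : H ≋ G ∥ᴴ Γ , x ⦂ ∃ᵗ B ∥ᴴ Δ , y ⦂ ∀ᵗ dual B) (k : K ≐ G ∥ᴴ Γ ++ Δ)
           → D ─⟨ x [ A ]ᵗ ∥ y ⦅ A ⦆ᵗ ⟩→ D′
           → (h′ : H′ ≋ G ∥ᴴ Γ , x ⦂ B [ A /X] ∥ᴴ Δ , y ⦂ dual (B [ A /X])) (k′ : K′ ≐ G ∥ᴴ Γ ++ Δ)
           → ⊢cut {A = ∃ᵗ B} h k D ─⟨ τ ⟩→ ⊢cut h′ k′ D′
    com-?! : (h : H ≋ G ∥ᴴ Γ , x ⦂ ?ᵗ A ∥ᴴ Δ , y ⦂ !ᵗ dual A) (k : K ≐ G ∥ᴴ Γ ++ Δ)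
           → D ─⟨ ¿ x [ x′ ] ∥ ! y ⦅ y′ ⦆ ⟩→ D′
           → (h′ : H′ ≋ G ∥ᴴ Γ , x′ ⦂ A ∥ᴴ Δ , y′ ⦂ dual A) (k′ : K′ ≐ G ∥ᴴ Γ ++ Δ)
           → ⊢cut {A = ?ᵗ A} h k D ─⟨ τ ⟩→ ⊢cut h′ k′ D′
    com-C! : (h : H ≋ G ∥ᴴ Γ , x ⦂ ?ᵗ A ∥ᴴ ?ᴱ Δ , y ⦂ !ᵗ dual A) (k : K ≐ G ∥ᴴ Γ ++ ?ᴱ Δ)
           → D ─⟨ ¿ x [ x₁ ∣ x₂ ] ∥ ! y ⦅ y₁ ∣ y₂ ⦆ ⟩→ D′
           → (h′ : H′ ≋ G ∥ᴴ Γ , x₁ ⦂ ?ᵗ A ⅋ ?ᵗ A ∥ᴴ ?ᴱ Δ , y₁ ⦂ !ᵗ dual A ⊗ !ᵗ dual A)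
             (k′ : K′ ≐ G ∥ᴴ Γ ++ ?ᴱ Δ)
           → ⊢cut {A = ?ᵗ A} h k D ─⟨ τ ⟩→ ⊢cut {A = ?ᵗ A ⅋ ?ᵗ A} h′ k′ D′
    com-W! : (h : H ≋ G ∥ᴴ Γ , x ⦂ ?ᵗ A ∥ᴴ ?ᴱ Δ , y ⦂ !ᵗ dual A) (k : K ≐ G ∥ᴴ Γ ++ ?ᴱ Δ)
           → D ─⟨ ¿ x [] ∥ ! y ⦅⦆ ⟩→ D′
           → (h′ : H′ ≋ G ∥ᴴ Γ , x ⦂ ⊥ᵗ ∥ᴴ ?ᴱ Δ , y ⦂ 𝟏) (k′ : K′ ≐ G ∥ᴴ Γ ++ ?ᴱ Δ)
           → ⊢cut {A = ?ᵗ A} h k D ─⟨ τ ⟩→ ⊢cut {A = ⊥ᵗ} h′ k′ D′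

    -- With B = A⊥ this is the shape z : A⊥, y : A ∥ Γ, x : A⊥,
    -- duality being involutive.
    link : {D : ⊢ P ∶∶ H} {D′ : ⊢ P′ ∶∶ H′} {E : ⊢ Q ∶∶ K′}
           (h : H ≋ G ∥ᴴ Γ , x ⦂ B ∥ᴴ (∅ , z ⦂ B) , y ⦂ dual B) (k : K ≐ G ∥ᴴ Γ ++ (∅ , z ⦂ B))
         → D ─⟨ z ↔ y ⟩→ D′ → z ≢ x → z ≢ y
         → H′ ≋ G ∥ᴴ Γ , x ⦂ B
         → E ≈ D′ ⟦ z for x ⟧ⁿ → K′ ≋ G ∥ᴴ Γ , z ⦂ B
         → ⊢cut h k D ─⟨ τ ⟩→ E

{-# OPTIONS --safe #-}
module Submission where

-- The two actions of l₁ ∥ l₂ come from the two sides of a parallel composition (syn), where each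
-- can be performed on its own; parallel bystanders and restrictions are then wrapped around both
-- steps.  The difficulty is the restriction (νxy): the intermediate derivation must again contain x
-- and y with dual types and in two different environments.  It does, because a step preserves the
-- type of every name outside its label, and may split an environment but never merges two.

open import Defs
open import Data.List.Relation.Binary.Disjoint.Propositional using (Disjoint)
open import Data.Nat using (ℕ)
open import Data.Product using (_×_; Σ-syntax; ∃-syntax)

open import Data.Empty using (⊥-elim)
open import Data.Product using (∃₂; _,_; proj₁; proj₂) renaming (map to map×; swap to swap×)
open import Data.Product using () renaming (_,_ to infix 6 _⦂_)
open import Data.Sum as Sum using (_⊎_; inj₁; inj₂; [_,_]′)
open import Data.List using (List; _∷_; _++_; map; concat) renaming ([] to ∅)
open import Data.List.Properties using (++-assoc; map-++)
open import Data.List.Membership.Propositional using (_∈_; _∉_)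
open import Data.List.Membership.Propositional.Properties
  using (∈-++⁺ˡ; ∈-++⁺ʳ; ∈-++⁻; ∈-∃++; ∈-concat⁻′; ∈-filter⁺; ∈-filter⁻; ∈-map⁺)
open import Data.List.Relation.Binary.BagAndSetEquality
  using (_∼[_]_; set; ∷-cong; ++-cong; ++-idempotent; [_]-Equality)
open import Data.List.Relation.Binary.Disjoint.Propositional.Properties using () renaming (sym to Disjoint-sym)
open import Data.List.Relation.Binary.Permutation.Homogeneous as Homogeneous using ()
open import Data.List.Relation.Binary.Permutation.Propositional
  using (_↭_; ↭-refl; ↭-sym; ↭-trans; ↭-reflexive; ↭-setoid; ↭-prep; ↭-swap; ↭⇒↭ₛ)
open import Data.List.Relation.Binary.Permutation.Propositional.Properties
  using (++⁺; shift; shifts; ∈-resp-↭; ++-identityʳ)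
  renaming (map⁺ to map⁺-↭)
import Data.List.Relation.Binary.Permutation.Setoid as SetoidPermutation
import Data.List.Relation.Binary.Permutation.Setoid.Properties as SetoidPermutationProperties
open import Data.List.Relation.Binary.Pointwise as Pointwise using (Pointwise; _∷_)
open import Data.List.Relation.Binary.Subset.Propositional using (_⊆_)
open import Data.List.Relation.Binary.Subset.Propositional.Properties using () renaming (map⁺ to map⁺-⊆)
open import Data.List.Relation.Unary.All as All using (All; _∷_)
open import Data.List.Relation.Unary.AllPairs using (_∷_)
open import Data.List.Relation.Unary.Any using (Any; here; there)
open import Data.List.Relation.Unary.Any.Properties using () renaming (++⁻ to Any-++⁻; ++⁺ˡ to Any-++⁺ˡ; ++⁺ʳ to Any-++⁺ʳ)
open import Data.List.Relation.Unary.Unique.Propositional using (Unique)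
import Data.List.Relation.Unary.Unique.Propositional.Properties as Unique
open import Function using (_∘_)
open import Function.Bundles using (mk⇔; module Equivalence)
open import Relation.Binary.Bundles using (Setoid)
open import Relation.Binary.PropositionalEquality
  using (_≡_; _≢_; refl; sym; trans; cong; subst; setoid)
open import Relation.Nullary using (¬_; ¬?)

module Serialisation (𝒩 : Names) where

  open Names 𝒩
  open πLL 𝒩 hiding (_,_)
  open Equivalence using (to; from)

  module ≋ {n : ℕ} where
    open SetoidPermutation (↭-setoid {A = Name × Ty n}) public
      using () renaming (↭-refl to reflexive; ↭-sym to symmetric; ↭-trans to transitive; ↭-prep to prep; ↭-swap to swap)
    open SetoidPermutationProperties (↭-setoid {A = Name × Ty n}) public
      using (Any-resp-↭; ++-comm) renaming (shift to shift-≈)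

  module ∼ = Setoid ([ set ]-Equality Name)

  private variable
    n                 : ℕ
    x y z u v         : Name
    xs ys zs          : List Name
    A B C             : Ty n
    P P′ Q Q′         : Proc n
    Γ Γ′ Δ Δ′         : Env n
    G G′ H H′ K K′    : HEnv n
    l l₁ l₂           : Act n

  -- Disjoint and duplicate-free lists of names.

  #-mono : ys ⊆ zs → Disjoint xs zs → Disjoint xs ys
  #-mono ys⊆zs # (z∈xs , z∈ys) = # (z∈xs , ys⊆zs z∈ys)

  ++-#⁻ˡ : Disjoint (xs ++ ys) zs → Disjoint xs zs
  ++-#⁻ˡ # (z∈xs , z∈zs) = # (∈-++⁺ˡ z∈xs , z∈zs)

  ++-#⁻ʳ : ∀ xs → Disjoint (xs ++ ys) zs → Disjoint ys zs
  ++-#⁻ʳ xs # (z∈ys , z∈zs) = # (∈-++⁺ʳ xs z∈ys , z∈zs)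

  Unique-resp-↭ : xs ↭ ys → Unique xs → Unique ys
  Unique-resp-↭ = SetoidPermutationProperties.Unique-resp-↭ (setoid Name) ∘ ↭⇒↭ₛ

  head-∉ : Unique (x ∷ xs) → x ∉ xs
  head-∉ (x≢ ∷ _) x∈ = All.lookup x≢ x∈ refl

  tail-∈ : z ≢ x → z ∈ x ∷ xs → z ∈ xs
  tail-∈ z≢x (here z≡x) = ⊥-elim (z≢x z≡x)
  tail-∈ z≢x (there z∈) = z∈

  ++-Unique⇒Disjoint : ∀ xs → Unique (xs ++ ys) → Disjoint xs ys
  ++-Unique⇒Disjoint (_ ∷ xs) uniq       (here refl , z∈ys)  = head-∉ uniq (∈-++⁺ʳ xs z∈ys)
  ++-Unique⇒Disjoint (_ ∷ xs) (_ ∷ uniq) (there z∈xs , z∈ys) = ++-Unique⇒Disjoint xs uniq (z∈xs , z∈ys)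

  -- Hyperenvironments

  names : Env n → List Name
  names = map proj₁

  dom : HEnv n → List Name
  dom = names ∘ concat

  concat-↭ : G ≋ H → concat G ↭ concat H
  concat-↭ (Homogeneous.refl Γs)       = pointwise Γs
    where
    pointwise : {G H : HEnv n} → Pointwise _↭_ G H → concat G ↭ concat H
    pointwise Pointwise.[] = ↭-refl
    pointwise (p ∷ ps)     = ++⁺ p (pointwise ps)
  concat-↭ (Homogeneous.prep p ps)     = ++⁺ p (concat-↭ ps)
  concat-↭ (Homogeneous.swap {x = Γ} {y = Δ} p q ps) =
    ↭-trans (shifts Γ Δ) (++⁺ q (++⁺ p (concat-↭ ps)))
  concat-↭ (Homogeneous.trans ps qs)   = ↭-trans (concat-↭ ps) (concat-↭ qs)

  dom-↭ : G ≋ H → dom G ↭ dom H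
  dom-↭ = map⁺-↭ proj₁ ∘ concat-↭

  Distinct-resp-≋ : G ≋ H → Distinct G → Distinct H
  Distinct-resp-≋ = Unique-resp-↭ ∘ dom-↭

  names-++ : (Γ Δ : Env n) → names (Γ ++ Δ) ≡ names Γ ++ names Δ
  names-++ = map-++ proj₁

  names-++⁻ : (Γ : Env n) → z ∈ names (Γ ++ Δ) → z ∈ names Γ ⊎ z ∈ names Δ
  names-++⁻ {Δ = Δ} Γ = ∈-++⁻ (names Γ) ∘ subst (_ ∈_) (names-++ Γ Δ)

  names-++⁺ˡ : z ∈ names Γ → z ∈ names (Γ ++ Δ)
  names-++⁺ˡ = map⁺-⊆ proj₁ ∈-++⁺ˡ

  names-++⁺ʳ : (Γ : Env n) → z ∈ names Δ → z ∈ names (Γ ++ Δ)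
  names-++⁺ʳ Γ = map⁺-⊆ proj₁ (∈-++⁺ʳ Γ)

  concat-++ : (G H : HEnv n) → concat (G ++ H) ≡ concat G ++ concat H
  concat-++ ∅       H = refl
  concat-++ (Γ ∷ G) H = trans (cong (Γ ++_) (concat-++ G H)) (sym (++-assoc Γ _ _))

  dom-++ : (G H : HEnv n) → dom (G ++ H) ≡ dom G ++ dom H
  dom-++ G H = trans (cong names (concat-++ G H)) (names-++ (concat G) (concat H))

  ≐⇒Disjoint : (G H : HEnv n) → K ≐ G ++ H → Disjoint (dom G) (dom H)
  ≐⇒Disjoint G H (k , d) = ++-Unique⇒Disjoint (dom G) (subst Unique (dom-++ G H) (Distinct-resp-≋ k d))

  ++-Distinct : (G H : HEnv n) → Distinct G → Distinct H → Disjoint (dom G) (dom H) → Distinct (G ++ H)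
  ++-Distinct G H dG dH G#H = subst Unique (sym (dom-++ G H)) (Unique.++⁺ dG dH G#H)

  ≐-⊆ˡ : (G H : HEnv n) → K ≐ G ++ H → dom G ⊆ dom K
  ≐-⊆ˡ G H (k , _) = ∈-resp-↭ (↭-sym (dom-↭ k)) ∘ subst (_ ∈_) (sym (dom-++ G H)) ∘ ∈-++⁺ˡ

  ≐-⊆ʳ : (G H : HEnv n) → K ≐ G ++ H → dom H ⊆ dom K
  ≐-⊆ʳ G H (k , _) = ∈-resp-↭ (↭-sym (dom-↭ k)) ∘ subst (_ ∈_) (sym (dom-++ G H)) ∘ ∈-++⁺ʳ (dom G)

  names-wk : (Γ : Env n) → names (wk Γ) ≡ names Γ
  names-wk ∅       = refl
  names-wk (_ ∷ Γ) = cong (_ ∷_) (names-wk Γ)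

  Linked : HEnv n → Name → Name → Set
  Linked G u v = Any (λ Γ → u ∈ names Γ × v ∈ names Γ) G

  Linked-resp-≋ : G ≋ H → Linked G u v → Linked H u v
  Linked-resp-≋ = ≋.Any-resp-↭ λ p (u∈ , v∈) → ∈-resp-↭ (map⁺-↭ proj₁ p) u∈ , ∈-resp-↭ (map⁺-↭ proj₁ p) v∈

  Linked⇒∈ˡ : Linked G u v → u ∈ dom G
  Linked⇒∈ˡ               (here (u∈ , _)) = names-++⁺ˡ u∈
  Linked⇒∈ˡ {G = Γ ∷ _}   (there p)       = names-++⁺ʳ Γ (Linked⇒∈ˡ p)

  Linked⇒∈ʳ : Linked G u v → v ∈ dom G
  Linked⇒∈ʳ               (here (_ , v∈)) = names-++⁺ˡ v∈
  Linked⇒∈ʳ {G = Γ ∷ _}   (there p)       = names-++⁺ʳ Γ (Linked⇒∈ʳ p)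

  isolate : {xA : Name × Ty n} (G : HEnv n) → xA ∈ concat G → ∃₂ λ H Γ → G ≋ (xA ∷ Γ) ∷ H
  isolate {xA = xA} G xA∈ with ∈-concat⁻′ G xA∈
  ... | Γ , xA∈Γ , Γ∈G with ∈-∃++ xA∈Γ | ∈-∃++ Γ∈G
  ... | Γ₁ , Γ₂ , refl | G₁ , G₂ , refl =
    G₁ ++ G₂ , Γ₁ ++ Γ₂ , ≋.shift-≈ (shift xA Γ₁ Γ₂) G₁ G₂

  -- Once the environment of `x` is pulled to the front, an entry of `y` inside it would link the
  -- two names. So `y` lies in the rest, and its environment can be pulled out as well. This
  -- rebuilds the shape that Cut demands of its premise.
  isolate₂ : (G : HEnv n) → (x ⦂ A) ∈ concat G → (y ⦂ B) ∈ concat G → ¬ Linked G x y →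
             ∃₂ λ H Γ → ∃[ Δ ] (G ≋ H ∥ᴴ ((x ⦂ A) ∷ Γ) ∥ᴴ ((y ⦂ B) ∷ Δ))
  isolate₂ G x∈ y∈ ¬xy with isolate G x∈
  ... | H , Γ , p with ∈-++⁻ (_ ∷ Γ) (∈-resp-↭ (concat-↭ p) y∈)
  ... | inj₁ y∈Γ = ⊥-elim (¬xy (Linked-resp-≋ (≋.symmetric p) (here (here refl , ∈-map⁺ proj₁ y∈Γ))))
  ... | inj₂ y∈H with isolate H y∈H
  ... | H′ , Δ , q = H′ , Γ , Δ , ≋.transitive p (≋.transitive (≋.prep _ q) (≋.swap _ _ ≋.reflexive))

  -- The premises of Cut and of ⊗ share this shape, so one rearrangement serves both; ⊗ is the
  -- instance with `G` empty.
  cut-↭ : (Γ Δ : Env n) (G : HEnv n) →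
          concat (G ∥ᴴ ((x ⦂ A) ∷ Γ) ∥ᴴ ((y ⦂ B) ∷ Δ)) ↭ (x ⦂ A) ∷ (y ⦂ B) ∷ concat (G ∥ᴴ (Γ ++ Δ))
  cut-↭ Γ Δ G = ↭-trans
    (↭-prep _ (↭-trans (shift _ Δ _)
      (↭-prep _ (↭-trans (shifts Δ Γ) (↭-reflexive (sym (++-assoc Γ Δ _)))))))
    (↭-swap _ _ ↭-refl)

  -- Comparison of the premise `H` of a cut with its conclusion `K`. The types `A` and `B` are
  -- independent here, which makes the setting symmetric: through `≋-swap` each fact about `x`
  -- yields one about `y`.
  module Cut {H K G : HEnv n} {Γ Δ : Env n} {x y : Name} {A B : Ty n}
             (h : H ≋ G ∥ᴴ ((x ⦂ A) ∷ Γ) ∥ᴴ ((y ⦂ B) ∷ Δ)) (k : K ≋ G ∥ᴴ (Γ ++ Δ))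
             (distinct : Distinct H) where

    entries-↭ : concat H ↭ (x ⦂ A) ∷ (y ⦂ B) ∷ concat K
    entries-↭ = ↭-trans (concat-↭ h)
      (↭-trans (cut-↭ Γ Δ G) (↭-prep _ (↭-prep _ (↭-sym (concat-↭ k)))))

    names-↭ : dom H ↭ x ∷ y ∷ dom K
    names-↭ = map⁺-↭ proj₁ entries-↭

    unique : Unique (x ∷ y ∷ dom K)
    unique = Unique-resp-↭ names-↭ distinct

    unique′ : Unique (x ∷ y ∷ dom (G ∥ᴴ (Γ ++ Δ)))
    unique′ = Unique-resp-↭ (↭-prep _ (↭-prep _ (dom-↭ k))) unique

    K-distinct : Distinct K
    K-distinct with unique
    ... | _ ∷ _ ∷ u = u

    x∈H : x ∈ dom H
    x∈H = ∈-resp-↭ (↭-sym names-↭) (here refl)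

    y∈H : y ∈ dom H
    y∈H = ∈-resp-↭ (↭-sym names-↭) (there (here refl))

    K⊆H : dom K ⊆ dom H
    K⊆H = ∈-resp-↭ (↭-sym names-↭) ∘ there ∘ there

    ≢x : z ∈ dom K → z ≢ x
    ≢x z∈ refl = head-∉ unique (there z∈)

    ≢y : z ∈ dom K → z ≢ y
    ≢y z∈ refl with unique
    ... | _ ∷ u = head-∉ u z∈

    H⊆K : z ≢ x → z ≢ y → z ∈ dom H → z ∈ dom K
    H⊆K z≢x z≢y = tail-∈ z≢y ∘ tail-∈ z≢x ∘ ∈-resp-↭ names-↭

    ∈K⇒∈H : (z ⦂ C) ∈ concat K → (z ⦂ C) ∈ concat H
    ∈K⇒∈H = ∈-resp-↭ (↭-sym entries-↭) ∘ there ∘ there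

    ∈H⇒∈K : z ≢ x → z ≢ y → (z ⦂ C) ∈ concat H → (z ⦂ C) ∈ concat K
    ∈H⇒∈K z≢x z≢y z∈ with ∈-resp-↭ entries-↭ z∈
    ... | here refl         = ⊥-elim (z≢x refl)
    ... | there (here refl) = ⊥-elim (z≢y refl)
    ... | there (there z∈K) = z∈K

    -- A cut deletes its two endpoints and joins their environments; it separates nothing else.
    linked⁺ : z ≢ x → z ≢ y → u ≢ x → u ≢ y → Linked H z u → Linked K z u
    linked⁺ z≢x z≢y u≢x u≢y zu with Linked-resp-≋ h zu
    ... | here (z∈ , u∈)         = Linked-resp-≋ (≋.symmetric k)
                                     (here (names-++⁺ʳ Γ (tail-∈ z≢y z∈) , names-++⁺ʳ Γ (tail-∈ u≢y u∈)))
    ... | there (here (z∈ , u∈)) = Linked-resp-≋ (≋.symmetric k)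
                                     (here (names-++⁺ˡ (tail-∈ z≢x z∈) , names-++⁺ˡ (tail-∈ u≢x u∈)))
    ... | there (there zu′)      = Linked-resp-≋ (≋.symmetric k) (there zu′)

    -- `x` occurs only once in `H`, so finding it in any environment other than its own contradicts
    -- `unique′`.
    linked-x : z ≢ x → Linked H z x → z ∈ names Γ
    linked-x z≢x zx with Linked-resp-≋ h zx | unique′
    ... | here (_ , here refl)   | u = ⊥-elim (head-∉ u (here refl))
    ... | here (_ , there x∈)    | u = ⊥-elim (head-∉ u (there (names-++⁺ˡ (names-++⁺ʳ Γ x∈))))
    ... | there (here (z∈ , _))  | _ = tail-∈ z≢x z∈
    ... | there (there zx′)      | u = ⊥-elim (head-∉ u (there (names-++⁺ʳ (Γ ++ Δ) (Linked⇒∈ʳ zx′))))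

    ¬linked-xy : ¬ Linked H x y
    ¬linked-xy xy with Linked-resp-≋ h xy | unique′
    ... | here (here refl , _)          | u = head-∉ u (here refl)
    ... | here (there x∈ , _)           | u = head-∉ u (there (names-++⁺ˡ (names-++⁺ʳ Γ x∈)))
    ... | there (here (_ , here refl))  | u = head-∉ u (here refl)
    ... | there (here (_ , there y∈))   | _ ∷ u = head-∉ u (names-++⁺ˡ (names-++⁺ˡ y∈))
    ... | there (there xy′)             | _ ∷ u = head-∉ u (names-++⁺ʳ (Γ ++ Δ) (Linked⇒∈ʳ xy′))

  ≋-swap : H ≋ G ∥ᴴ Γ ∥ᴴ Δ → H ≋ G ∥ᴴ Δ ∥ᴴ Γ
  ≋-swap h = ≋.transitive h (≋.swap _ _ ≋.reflexive)

  -- Typed processes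

  distinct : ⊢ P ∶∶ G → Distinct G
  distinct (⊢ax k)         = proj₂ k
  distinct (⊢cut _ k _)    = proj₂ k
  distinct (⊢mix k _ _)    = proj₂ k
  distinct (⊢mix₀ k)       = proj₂ k
  distinct (⊢⊗ _ k _)      = proj₂ k
  distinct (⊢1 _ k _)      = proj₂ k
  distinct (⊢⅋ _ k _)      = proj₂ k
  distinct (⊢⊥ _ k _)      = proj₂ k
  distinct (⊢⊕₁ _ k _)     = proj₂ k
  distinct (⊢⊕₂ _ k _)     = proj₂ k
  distinct (⊢& _ _ k _ _)  = proj₂ k
  distinct (⊢! _ k _)      = proj₂ k
  distinct (⊢? _ k _)      = proj₂ k
  distinct (⊢W _ k _)      = proj₂ k
  distinct (⊢C _ k _)      = proj₂ k
  distinct (⊢∃ _ k _)      = proj₂ k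
  distinct (⊢∀ _ k _)      = proj₂ k

  -- Free names of a process and names of its hyperenvironment.

  ↭⇒∼ : xs ↭ ys → xs ∼[ set ] ys
  ↭⇒∼ p = mk⇔ (∈-resp-↭ p) (∈-resp-↭ (↭-sym p))

  -- `_-_` deletes every occurrence of `y`, and uniqueness of `ys` guarantees that none is left in
  -- `zs`.
  minus-∼ : Unique ys → ys ↭ y ∷ zs → xs ∼[ set ] ys → xs - y ∼[ set ] zs
  minus-∼ {y = y} uniq p e = mk⇔
    (λ z∈ → let z∈xs , z≢y = ∈-filter⁻ (λ w → ¬? (w ≟ y)) z∈
            in tail-∈ z≢y (∈-resp-↭ p (to e z∈xs)))
    (λ z∈ → ∈-filter⁺ (λ w → ¬? (w ≟ y)) (from e (∈-resp-↭ (↭-sym p) (there z∈)))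
              λ { refl → head-∉ (Unique-resp-↭ p uniq) z∈ })

  minus²-∼ : Unique ys → ys ↭ x ∷ y ∷ zs → xs ∼[ set ] ys → xs - x - y ∼[ set ] zs
  minus²-∼ uniq p e with Unique-resp-↭ p uniq
  ... | _ ∷ uniq′ = minus-∼ uniq′ ↭-refl (minus-∼ uniq p e)

  rule-∼ : K ≋ ((x ⦂ C) ∷ Γ) ∷ ∅ → xs ∼[ set ] dom (Γ ∷ ∅) → x ∷ xs ∼[ set ] dom K
  rule-∼ k e = ∼.trans (∷-cong refl e) (↭⇒∼ (↭-sym (dom-↭ k)))

  -- For the rules whose continuation still uses the subject `x`: `fn` then lists `x` again, a
  -- repetition that set equality ignores.
  rule-∼′ : K ≋ ((x ⦂ C) ∷ Γ) ∷ ∅ → xs ∼[ set ] x ∷ dom (Γ ∷ ∅) → x ∷ xs ∼[ set ] dom K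
  rule-∼′ k e = ∼.trans (∷-cong refl e)
    (∼.trans (mk⇔ (λ { (here p) → here p ; (there p) → p }) there) (↭⇒∼ (↭-sym (dom-↭ k))))

  -- Freshness conditions on transitions mention `fn`, whereas well-formedness of hyperenvironments
  -- mentions `dom`; this translates between them. Only set equality can hold, because `fn` repeats
  -- names, for instance those shared by the two branches of a &.
  fn∼dom : ⊢ P ∶∶ G → fn P ∼[ set ] dom G
  fn∼dom (⊢ax (k , _)) =
    ↭⇒∼ (↭-trans (↭-swap _ _ ↭-refl) (↭-sym (dom-↭ k)))
  fn∼dom (⊢cut h (k , _) D) = minus²-∼ (distinct D) (Cut.names-↭ h k (distinct D)) (fn∼dom D)
  fn∼dom (⊢mix {G = G} {H = H} (k , _) D E) = ∼.trans (++-cong (fn∼dom D) (fn∼dom E))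
    (↭⇒∼ (↭-sym (↭-trans (dom-↭ k) (↭-reflexive (dom-++ G H)))))
  fn∼dom (⊢mix₀ (k , _)) = ↭⇒∼ (↭-sym (dom-↭ k))
  fn∼dom (⊢⊗ {Γ = Γ} {A = A} {Δ = Δ} {B = B} h (k , _) D) = rule-∼′ k
    (minus-∼ (distinct D) (↭-trans (dom-↭ h) (map⁺-↭ proj₁ (cut-↭ {A = A} {B = B} Γ Δ ∅))) (fn∼dom D))
  fn∼dom (⊢1 h (k , _) D) = rule-∼ k (∼.trans (fn∼dom D) (↭⇒∼ (dom-↭ h)))
  fn∼dom (⊢⅋ h (k , _) D) = rule-∼′ k
    (minus-∼ (distinct D) (↭-trans (dom-↭ h) (↭-swap _ _ ↭-refl)) (fn∼dom D))
  fn∼dom (⊢⊥ h (k , _) D) = rule-∼ k (∼.trans (fn∼dom D) (↭⇒∼ (dom-↭ h)))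
  fn∼dom (⊢⊕₁ h (k , _) D) = rule-∼′ k (∼.trans (fn∼dom D) (↭⇒∼ (dom-↭ h)))
  fn∼dom (⊢⊕₂ h (k , _) D) = rule-∼′ k (∼.trans (fn∼dom D) (↭⇒∼ (dom-↭ h)))
  fn∼dom (⊢& h₁ h₂ (k , _) D E) = rule-∼′ k
    (∼.trans (++-cong (∼.trans (fn∼dom D) (↭⇒∼ (dom-↭ h₁))) (∼.trans (fn∼dom E) (↭⇒∼ (dom-↭ h₂))))
             (++-idempotent _))
  fn∼dom (⊢! h (k , _) D) = rule-∼ k (minus-∼ (distinct D) (dom-↭ h) (fn∼dom D))
  fn∼dom (⊢? h (k , _) D) = rule-∼ k (minus-∼ (distinct D) (dom-↭ h) (fn∼dom D))
  fn∼dom (⊢W h (k , _) D) = rule-∼ k (∼.trans (fn∼dom D) (↭⇒∼ (dom-↭ h)))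
  fn∼dom (⊢C h (k , _) D) = rule-∼ k
    (minus²-∼ (distinct D) (↭-trans (dom-↭ h) (↭-swap _ _ ↭-refl)) (fn∼dom D))
  fn∼dom (⊢∃ h (k , _) D) = rule-∼′ k (∼.trans (fn∼dom D) (↭⇒∼ (dom-↭ h)))
  fn∼dom (⊢∀ {Γ = Γ} {x = x} h (k , _) D) = rule-∼′ k (∼.trans (fn∼dom D)
    (↭⇒∼ (↭-trans (dom-↭ h) (↭-reflexive (cong (x ∷_) dom-wk)))))
    where
    dom-wk : dom (wk Γ ∷ ∅) ≡ dom (Γ ∷ ∅)
    dom-wk = trans (names-++ (wk Γ) ∅) (trans (cong (_++ ∅) (names-wk Γ)) (sym (names-++ Γ ∅)))

  #fn⇒#dom : ⊢ P ∶∶ G → Disjoint xs (fn P) → Disjoint xs (dom G)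
  #fn⇒#dom D = #-mono (from (fn∼dom D))

  #dom⇒#fn : ⊢ P ∶∶ G → Disjoint xs (dom G) → Disjoint xs (fn P)
  #dom⇒#fn D = #-mono (to (fn∼dom D))

  mix-≐ : ⊢ P ∶∶ G → ⊢ Q ∶∶ H → Disjoint (dom G) (dom H) → G ++ H ≐ G ++ H
  mix-≐ {G = G} {H = H} D E G#H = ≋.reflexive , ++-Distinct G H (distinct D) (distinct E) G#H

  -- The effect of an action on hyperenvironments

  -- What an intermediate Mix or Cut needs to know about the first action. `splits` says that
  -- environments are never merged; it is restricted to pairs of old names, since a bound name
  -- entering in `G′` has no place in `G`. `keeps` leaves out the names of the label, whose entries
  -- the action may change.
  record Step (l : Act n) (G G′ : HEnv n) : Set where
    field
      names⊆ : z ∈ dom G′ → z ∈ dom G ⊎ z ∈ bnᴬ l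
      keeps  : z ∉ cn (act l) → (z ⦂ C) ∈ concat G → (z ⦂ C) ∈ concat G′
      splits : u ∈ dom G → v ∈ dom G → Linked G′ u v → Linked G u v
  open Step

  Step-resp-≋ : G ≋ H → G′ ≋ H′ → Step l H H′ → Step l G G′
  Step-resp-≋ p q s = record
    { names⊆ = Sum.map₁ (∈-resp-↭ (↭-sym (dom-↭ p))) ∘ names⊆ s ∘ ∈-resp-↭ (dom-↭ q)
    ; keeps  = λ z∉ → ∈-resp-↭ (↭-sym (concat-↭ q)) ∘ keeps s z∉ ∘ ∈-resp-↭ (concat-↭ p)
    ; splits = λ u∈ v∈ → Linked-resp-≋ (≋.symmetric p) ∘ splits s (∈-resp-↭ (dom-↭ p) u∈) (∈-resp-↭ (dom-↭ p) v∈) ∘ Linked-resp-≋ q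
    }

  -- Every action prefix lives in a single environment, so it cannot merge two.
  prefix-step : (l : Act n) (Θ : Env n) → K ≋ ((subj l ⦂ C) ∷ Γ) ∷ ∅ → concat K′ ↭ Θ ++ concat (Γ ∷ ∅) →
                All (_∈ cn (act l)) (names Θ) → Step l K K′
  prefix-step {K = K} {C = C} {Γ = Γ} {K′ = K′} l Θ k k′ Θ⊆ = record
    { names⊆ = λ z∈ → [ subject-or-bound ∘ All.lookup Θ⊆ , inj₁ ∘ in-K ∘ there ]′
                         (names-++⁻ Θ (∈-resp-↭ (map⁺-↭ proj₁ k′) z∈))
    ; keeps  = keep
    ; splits = λ u∈ v∈ _ → Linked-resp-≋ (≋.symmetric k) (here (in-Γ u∈ , in-Γ v∈))
    }
    where
    in-K : z ∈ dom (((subj l ⦂ C) ∷ Γ) ∷ ∅) → z ∈ dom K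
    in-K = ∈-resp-↭ (↭-sym (dom-↭ k))

    in-Γ : z ∈ dom K → z ∈ names ((subj l ⦂ C) ∷ Γ)
    in-Γ = ∈-resp-↭ (map⁺-↭ proj₁ (++-identityʳ ((subj l ⦂ C) ∷ Γ))) ∘ ∈-resp-↭ (dom-↭ k)

    subject-or-bound : z ∈ cn (act l) → z ∈ dom K ⊎ z ∈ bnᴬ l
    subject-or-bound (here refl) = inj₁ (in-K (here refl))
    subject-or-bound (there z∈)  = inj₂ z∈

    keep : z ∉ cn (act l) → (z ⦂ A) ∈ concat K → (z ⦂ A) ∈ concat K′
    keep z∉ z∈ with ∈-resp-↭ (concat-↭ k) z∈
    ... | here refl  = ⊥-elim (z∉ (here refl))
    ... | there z∈Γ = ∈-resp-↭ (↭-sym k′) (∈-++⁺ʳ Θ z∈Γ)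

  -- Disjointness of `G′` and `H` matters for `splits`: an old name found in `G′` cannot come from
  -- `H`, so it was already in `G` and the given step applies.
  par-step : (G G′ H : HEnv n) → Disjoint (dom G′) (dom H) → Step l G G′ → Step l (G ++ H) (G′ ++ H)
  par-step {l = l} G G′ H G′#H s = record
    { names⊆ = λ z∈ → [ Sum.map₁ (in-++ ∘ inj₁) ∘ names⊆ s , inj₁ ∘ in-++ ∘ inj₂ ]′
                         (∈-++⁻ (dom G′) (subst (_ ∈_) (dom-++ G′ H) z∈))
    ; keeps  = λ z∉ z∈ → subst (_ ∈_) (sym (concat-++ G′ H))
                 ([ ∈-++⁺ˡ ∘ keeps s z∉ , ∈-++⁺ʳ (concat G′) ]′
                   (∈-++⁻ (concat G) (subst (_ ∈_) (concat-++ G H) z∈)))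
    ; splits = λ u∈ v∈ uv → [ (λ uv′ → Any-++⁺ˡ (splits s (in-G u∈ (Linked⇒∈ˡ uv′)) (in-G v∈ (Linked⇒∈ʳ uv′)) uv′))
                             , Any-++⁺ʳ G ]′ (Any-++⁻ G′ uv)
    }
    where
    in-++ : z ∈ dom G ⊎ z ∈ dom H → z ∈ dom (G ++ H)
    in-++ = subst (_ ∈_) (sym (dom-++ G H)) ∘ [ ∈-++⁺ˡ , ∈-++⁺ʳ (dom G) ]′

    in-G : z ∈ dom (G ++ H) → z ∈ dom G′ → z ∈ dom G
    in-G z∈ z∈G′ with ∈-++⁻ (dom G) (subst (_ ∈_) (dom-++ G H) z∈)
    ... | inj₁ z∈G = z∈G
    ... | inj₂ z∈H = ⊥-elim (G′#H (z∈G′ , z∈H))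

  module _ (h  : H  ≋ G  ∥ᴴ ((x ⦂ A) ∷ Γ)  ∥ᴴ ((y ⦂ B) ∷ Δ))  (k  : K  ≋ G  ∥ᴴ (Γ ++ Δ))
           (h′ : H′ ≋ G′ ∥ᴴ ((x ⦂ A) ∷ Γ′) ∥ᴴ ((y ⦂ B) ∷ Δ′)) (k′ : K′ ≋ G′ ∥ᴴ (Γ′ ++ Δ′))
           (d : Distinct H) (d′ : Distinct H′) where

    private
      module S = Cut h k d
      module T = Cut h′ k′ d′
      -- With the two sides exchanged, `linked-x` becomes the corresponding fact about `y` and `Δ`.
      module Sˢ = Cut (≋-swap h) ≋.reflexive d

    cut-step : Step l H H′ → Step l K K′
    cut-step s = record
      { names⊆ = λ z∈ → Sum.map₁ (S.H⊆K (T.≢x z∈) (T.≢y z∈)) (names⊆ s (T.K⊆H z∈))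
      ; keeps  = λ z∉ z∈ → T.∈H⇒∈K (S.≢x (∈-map⁺ proj₁ z∈)) (S.≢y (∈-map⁺ proj₁ z∈))
                              (keeps s z∉ (S.∈K⇒∈H z∈))
      ; splits = split
      }
      where
      split : u ∈ dom K → v ∈ dom K → Linked K′ u v → Linked K u v
      split {u = u} {v = v} u∈ v∈ uv = case (Linked-resp-≋ k′ uv)
        where
        same : Linked H′ u v → Linked K u v
        same = S.linked⁺ (S.≢x u∈) (S.≢y u∈) (S.≢x v∈) (S.≢y v∈) ∘ splits s (S.K⊆H u∈) (S.K⊆H v∈)

        -- In `H′` such a `z` is linked to `x`; `splits` carries this link back to `H`, where the
        -- environment of `x` is known.
        left : z ∈ dom K → z ∈ names Γ′ → z ∈ names Γ
        left z∈ z∈Γ′ = S.linked-x (S.≢x z∈) (splits s (S.K⊆H z∈) S.x∈H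
          (Linked-resp-≋ (≋.symmetric h′) (there (here (there z∈Γ′ , here refl)))))

        right : z ∈ dom K → z ∈ names Δ′ → z ∈ names Δ
        right z∈ z∈Δ′ = Sˢ.linked-x (S.≢y z∈) (splits s (S.K⊆H z∈) S.y∈H
          (Linked-resp-≋ (≋.symmetric h′) (here (there z∈Δ′ , here refl))))

        case : Linked (G′ ∥ᴴ (Γ′ ++ Δ′)) u v → Linked K u v
        case (there uv′) = same (Linked-resp-≋ (≋.symmetric h′) (there (there uv′)))
        case (here (u∈′ , v∈′)) with names-++⁻ Γ′ u∈′ | names-++⁻ Γ′ v∈′
        ... | inj₁ p | inj₁ q = same (Linked-resp-≋ (≋.symmetric h′) (there (here (there p , there q))))
        ... | inj₂ p | inj₂ q = same (Linked-resp-≋ (≋.symmetric h′) (here (there p , there q)))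
        -- Here the link in `K′` is created by the cut itself. The cut in the source creates it too,
        -- since one name comes from `Γ` and the other from `Δ`.
        ... | inj₁ p | inj₂ q = Linked-resp-≋ (≋.symmetric k) (here (names-++⁺ˡ (left u∈ p) , names-++⁺ʳ Γ (right v∈ q)))
        ... | inj₂ p | inj₁ q = Linked-resp-≋ (≋.symmetric k) (here (names-++⁺ʳ Γ (right u∈ p) , names-++⁺ˡ (left v∈ q)))

  -- Induction on the transition; an action label leaves only prefixes, α, Par and Res. For a
  -- prefix, the list given to `prefix-step` consists of the entries that replace the entry of the
  -- subject.
  act-step : {D : ⊢ P ∶∶ G} {D′ : ⊢ P′ ∶∶ G′} → D ─⟨ act l ⟩→ D′ → Step l G G′
  act-step (⊗→ {Γ = Γ} {y = y} {A = A} {Δ = Δ} {x = x} {B = B} h (k , _)) =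
    prefix-step (x [ y ]) ((y ⦂ A) ∷ (x ⦂ B) ∷ ∅) k (↭-trans (concat-↭ h) (cut-↭ Γ Δ ∅))
      (there (here refl) ∷ here refl ∷ All.[])
  act-step (⅋→ h (k , _)) = prefix-step _ (_ ∷ _ ∷ ∅) k (concat-↭ h) (here refl ∷ there (here refl) ∷ All.[])
  act-step (1→ h (k , _)) = prefix-step _ ∅ k (concat-↭ h) All.[]
  act-step (⊥→ h (k , _)) = prefix-step _ ∅ k (concat-↭ h) All.[]
  act-step (⊕₁→ h (k , _)) = prefix-step _ (_ ∷ ∅) k (concat-↭ h) (here refl ∷ All.[])
  act-step (⊕₂→ h (k , _)) = prefix-step _ (_ ∷ ∅) k (concat-↭ h) (here refl ∷ All.[])
  act-step (∃→ h (k , _)) = prefix-step _ (_ ∷ ∅) k (concat-↭ h) (here refl ∷ All.[])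
  act-step (?→ h (k , _)) = prefix-step _ (_ ∷ ∅) k (concat-↭ h) (there (here refl) ∷ All.[])
  act-step (!→ h (k , _)) = prefix-step _ (_ ∷ ∅) k (concat-↭ h) (there (here refl) ∷ All.[])
  act-step (&₁→ h _ (k , _)) = prefix-step _ (_ ∷ ∅) k (concat-↭ h) (here refl ∷ All.[])
  act-step (&₂→ _ h (k , _)) = prefix-step _ (_ ∷ ∅) k (concat-↭ h) (here refl ∷ All.[])
  act-step (∀→ _ (k , _) _ h) = prefix-step _ (_ ∷ ∅) k (concat-↭ h) (here refl ∷ All.[])
  act-step (W→ _ (k , _) (h , _)) = prefix-step _ (_ ∷ ∅) k (concat-↭ h) (here refl ∷ All.[])
  act-step (C→ _ (k , _) _ (h , _)) = prefix-step _ (_ ∷ ∅) k (concat-↭ h) (there (here refl) ∷ All.[])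
  act-step (!W→ _ (k , _) _ _ _ _ _ _ h) = prefix-step _ (_ ∷ ∅) k (concat-↭ h) (here refl ∷ All.[])
  act-step (!C→ _ (k , _) _ _ _ _ _ _ _ _ _ _ _ _ _ h) =
    prefix-step _ (_ ∷ ∅) k (concat-↭ h) (there (here refl) ∷ All.[])
  act-step (alpha _ p t) = Step-resp-≋ p ≋.reflexive (act-step t)
  act-step (parₗ {G = G} {G′ = G′} {H = H} (k , _) k′ t _) =
    Step-resp-≋ k (proj₁ k′) (par-step G G′ H (≐⇒Disjoint G′ H k′) (act-step t))
  -- Commuting both hyperenvironments reduces this case to a step on the left.
  act-step (parᵣ {G = G} {H = H} {H′ = H′} (k , _) k′ t _) =
    Step-resp-≋ (≋.transitive k (≋.++-comm G H)) (≋.transitive (proj₁ k′) (≋.++-comm G H′))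
      (par-step H H′ G (Disjoint-sym (≐⇒Disjoint G H′ k′)) (act-step t))
  act-step (res {D = D} {D′ = D′} h (k , _) h′ (k′ , _) t _ _) =
    cut-step h k h′ k′ (distinct D) (distinct D′) (act-step t)

  -- Serialisation

  Serial : {G G′ : HEnv n} → ⊢ P ∶∶ G → Act n → Act n → ⊢ P′ ∶∶ G′ → Set
  Serial {n = n} D l₁ l₂ D′ =
    ∃[ P″ ] ∃[ G″ ] Σ[ D″ ∈ ⊢_∶∶_ {n} P″ G″ ] (D ─⟨ act l₁ ⟩→ D″) × (D″ ─⟨ act l₂ ⟩→ D′)

  -- Keeps the two sides of an intermediate Mix disjoint: the only new names are bound names of the
  -- action.
  step-# : Step l G G′ → Disjoint (bnᴬ l) xs → Disjoint (dom G) xs → Disjoint (dom G′) xs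
  step-# s bn# G# (z∈G′ , z∈xs) = [ (λ z∈G → G# (z∈G , z∈xs)) , (λ z∈bn → bn# (z∈bn , z∈xs)) ]′ (names⊆ s z∈G′)

  -- `keeps` preserves the entries of `x` and `y`, and a link between them in `H′` would, by
  -- `splits`, be one in `H`, which a cut premise excludes. Hence `H′` is again a premise for
  -- cutting `x` against `y`.
  cut-between : H ≋ G ∥ᴴ ((x ⦂ A) ∷ Γ) ∥ᴴ ((y ⦂ B) ∷ Δ) → Distinct H → Step l H H′ →
                x ∉ cn (act l) → y ∉ cn (act l) →
                ∃₂ λ G′ Γ′ → ∃[ Δ′ ] (H′ ≋ G′ ∥ᴴ ((x ⦂ A) ∷ Γ′) ∥ᴴ ((y ⦂ B) ∷ Δ′))
  cut-between {H′ = H′} h d s x∉ y∉ = isolate₂ H′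
    (keeps s x∉ (∈-resp-↭ (↭-sym S.entries-↭) (here refl)))
    (keeps s y∉ (∈-resp-↭ (↭-sym S.entries-↭) (there (here refl))))
    (S.¬linked-xy ∘ splits s S.x∈H S.y∈H)
    where module S = Cut h ≋.reflexive d

  cn-∥ˡ : (l₁ l₂ : Act n) → cn (act l₁) ⊆ cn (l₁ ∥ l₂)
  cn-∥ˡ l₁ l₂ (here refl) = here refl
  cn-∥ˡ l₁ l₂ (there z∈)  = there (there (∈-++⁺ˡ z∈))

  cn-∥ʳ : (l₁ l₂ : Act n) → cn (act l₂) ⊆ cn (l₁ ∥ l₂)
  cn-∥ʳ l₁ l₂ (here refl) = there (here refl)
  cn-∥ʳ l₁ l₂ (there z∈)  = there (there (∈-++⁺ʳ (bnᴬ l₁) z∈))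

  alpha-Serial : {D : ⊢ P ∶∶ G} {E : ⊢ Q ∶∶ H} {D′ : ⊢ P′ ∶∶ G′} →
                 P =α Q → G ≋ H → Serial E l₁ l₂ D′ → Serial D l₁ l₂ D′
  alpha-Serial α p (_ , _ , E″ , t₁ , t₂) = _ , _ , E″ , alpha α p t₁ , t₂

  parₗ-Serial : {D : ⊢ P ∶∶ G} {D′ : ⊢ P′ ∶∶ G′} {E : ⊢ Q ∶∶ H} (k : K ≐ G ++ H) (k′ : K′ ≐ G′ ++ H) →
                Disjoint (bnᴬ l₁) (fn Q) → Disjoint (bnᴬ l₂) (fn Q) →
                Serial D l₁ l₂ D′ → Serial (⊢mix k D E) l₁ l₂ (⊢mix k′ D′ E)
  parₗ-Serial {G = G} {H = H} {E = E} k k′ bn₁# bn₂# (_ , G″ , D″ , t₁ , t₂) =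
    _ , _ , ⊢mix k″ D″ E , parₗ k k″ t₁ bn₁# , parₗ k″ k′ t₂ bn₂#
    where
    k″ = mix-≐ D″ E (step-# (act-step t₁) (#fn⇒#dom E bn₁#) (≐⇒Disjoint G H k))

  parᵣ-Serial : {D : ⊢ P ∶∶ G} {E : ⊢ Q ∶∶ H} {E′ : ⊢ Q′ ∶∶ H′} (k : K ≐ G ++ H) (k′ : K′ ≐ G ++ H′) →
                Disjoint (bnᴬ l₁) (fn P) → Disjoint (bnᴬ l₂) (fn P) →
                Serial E l₁ l₂ E′ → Serial (⊢mix k D E) l₁ l₂ (⊢mix k′ D E′)
  parᵣ-Serial {G = G} {H = H} {D = D} k k′ bn₁# bn₂# (_ , H″ , E″ , t₁ , t₂) =
    _ , _ , ⊢mix k″ D E″ , parᵣ k k″ t₁ bn₁# , parᵣ k″ k′ t₂ bn₂#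
    where
    k″ = mix-≐ D E″ (Disjoint-sym (step-# (act-step t₁) (#fn⇒#dom D bn₁#) (Disjoint-sym (≐⇒Disjoint G H k))))

  -- Performed in sequence, each action must have bound names fresh for the other component: the
  -- first for `E`, the second for the already reduced `D′`, whose names are old ones or bound by
  -- `l₁`. The three disjointness hypotheses cover exactly these cases.
  synₗᵣ-Serial : {D : ⊢ P ∶∶ G} {D′ : ⊢ P′ ∶∶ G′} {E : ⊢ Q ∶∶ H} {E′ : ⊢ Q′ ∶∶ H′}
                 (k : K ≐ G ++ H) (k′ : K′ ≐ G′ ++ H′) → D ─⟨ act l₁ ⟩→ D′ → E ─⟨ act l₂ ⟩→ E′ →
                 Disjoint (bnᴬ l₁) (dom H) → Disjoint (bnᴬ l₂) (dom G) → Disjoint (bnᴬ l₁) (bnᴬ l₂) →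
                 Serial (⊢mix k D E) l₁ l₂ (⊢mix k′ D′ E′)
  synₗᵣ-Serial {G = G} {H = H} {D′ = D′} {E = E} k k′ t u bn₁# bn₂# bn# =
    _ , _ , ⊢mix k″ D′ E , parₗ k k″ t (#dom⇒#fn E bn₁#) ,
    parᵣ k″ k′ u (#dom⇒#fn D′ (Disjoint-sym (step-# (act-step t) bn# (Disjoint-sym bn₂#))))
    where
    k″ = mix-≐ D′ E (step-# (act-step t) bn₁# (≐⇒Disjoint G H k))

  synᵣₗ-Serial : {D : ⊢ P ∶∶ G} {D′ : ⊢ P′ ∶∶ G′} {E : ⊢ Q ∶∶ H} {E′ : ⊢ Q′ ∶∶ H′}
                 (k : K ≐ G ++ H) (k′ : K′ ≐ G′ ++ H′) → D ─⟨ act l₁ ⟩→ D′ → E ─⟨ act l₂ ⟩→ E′ →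
                 Disjoint (bnᴬ l₁) (dom H) → Disjoint (bnᴬ l₂) (dom G) → Disjoint (bnᴬ l₁) (bnᴬ l₂) →
                 Serial (⊢mix k D E) l₂ l₁ (⊢mix k′ D′ E′)
  synᵣₗ-Serial {G = G} {H = H} {D = D} {E′ = E′} k k′ t u bn₁# bn₂# bn# =
    _ , _ , ⊢mix k″ D E′ , parᵣ k k″ u (#dom⇒#fn D bn₂#) ,
    parₗ k″ k′ t (#dom⇒#fn E′ (Disjoint-sym (step-# (act-step u) (Disjoint-sym bn#) (Disjoint-sym bn₁#))))
    where
    k″ = mix-≐ D E′ (Disjoint-sym (step-# (act-step u) bn₂# (Disjoint-sym (≐⇒Disjoint G H k))))

  res-Serial : {D : ⊢ P ∶∶ H} {D′ : ⊢ P′ ∶∶ H′}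
               (h  : H  ≋ G  ∥ᴴ ((x ⦂ A) ∷ Γ)  ∥ᴴ ((y ⦂ dual A) ∷ Δ))  (k  : K  ≐ G  ∥ᴴ (Γ ++ Δ))
               (h′ : H′ ≋ G′ ∥ᴴ ((x ⦂ A) ∷ Γ′) ∥ᴴ ((y ⦂ dual A) ∷ Δ′)) (k′ : K′ ≐ G′ ∥ᴴ (Γ′ ++ Δ′)) →
               x ∉ cn (act l₁) → y ∉ cn (act l₁) → x ∉ cn (act l₂) → y ∉ cn (act l₂) →
               Serial D l₁ l₂ D′ → Serial (⊢cut h k D) l₁ l₂ (⊢cut h′ k′ D′)
  res-Serial {D = D} h k h′ k′ x∉₁ y∉₁ x∉₂ y∉₂ (_ , _ , D″ , t₁ , t₂)
    with cut-between h (distinct D) (act-step t₁) x∉₁ y∉₁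
  -- The recovered splitting `h″` is the target shape of the first Res and the source shape of the
  -- second.
  ... | _ , _ , _ , h″ = _ , _ , ⊢cut h″ k″ D″ , res h k h″ k″ t₁ x∉₁ y∉₁ , res h″ k″ h′ k′ t₂ x∉₂ y∉₂
    where k″ = ≋.reflexive , Cut.K-distinct h″ ≋.reflexive (distinct D″)

  -- exch exchanges the two labels, so both orders are produced together.
  serialise : {D : ⊢ P ∶∶ G} {D′ : ⊢ P′ ∶∶ G′} → D ─⟨ l₁ ∥ l₂ ⟩→ D′ →
              Disjoint (bnᴬ l₁) (dom G) → Disjoint (bnᴬ l₂) (dom G) →
              Serial D l₁ l₂ D′ × Serial D l₂ l₁ D′
  -- Freshness is stated on `dom`, which agrees up to `↭` for the two α-equivalent derivations.
  serialise (alpha α p t) bn₁# bn₂# =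
    map× (alpha-Serial α p) (alpha-Serial α p)
      (serialise t (#-mono (∈-resp-↭ (↭-sym (dom-↭ p))) bn₁#) (#-mono (∈-resp-↭ (↭-sym (dom-↭ p))) bn₂#))
  serialise (exch t) bn₁# bn₂# = swap× (serialise t bn₂# bn₁#)
  serialise {l₁ = l₁} {l₂ = l₂} (parₗ {G = G} {Q = Q} {H = H} k k′ t bn#) bn₁# bn₂# =
    map× (parₗ-Serial k k′ E#₁ E#₂) (parₗ-Serial k k′ E#₂ E#₁)
      (serialise t (#-mono (≐-⊆ˡ G H k) bn₁#) (#-mono (≐-⊆ˡ G H k) bn₂#))
    where
    E#₁ : Disjoint (bnᴬ l₁) (fn Q)
    E#₁ = ++-#⁻ˡ bn#
    E#₂ : Disjoint (bnᴬ l₂) (fn Q)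
    E#₂ = ++-#⁻ʳ (bnᴬ l₁) bn#
  serialise {l₁ = l₁} {l₂ = l₂} (parᵣ {P = P} {G = G} {H = H} k k′ t bn#) bn₁# bn₂# =
    map× (parᵣ-Serial k k′ D#₁ D#₂) (parᵣ-Serial k k′ D#₂ D#₁)
      (serialise t (#-mono (≐-⊆ʳ G H k) bn₁#) (#-mono (≐-⊆ʳ G H k) bn₂#))
    where
    D#₁ : Disjoint (bnᴬ l₁) (fn P)
    D#₁ = ++-#⁻ˡ bn#
    D#₂ : Disjoint (bnᴬ l₂) (fn P)
    D#₂ = ++-#⁻ʳ (bnᴬ l₁) bn#
  serialise {l₁ = l₁} {l₂ = l₂} (syn {G = G} {H = H} k k′ t u bn#) bn₁# bn₂# =
    synₗᵣ-Serial k k′ t u H# G# bn# , synᵣₗ-Serial k k′ t u H# G# bn#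
    where
    H# : Disjoint (bnᴬ l₁) (dom H)
    H# = #-mono (≐-⊆ʳ G H k) bn₁#
    G# : Disjoint (bnᴬ l₂) (dom G)
    G# = #-mono (≐-⊆ˡ G H k) bn₂#
  serialise {l₁ = l₁} {l₂ = l₂} (res {D = D} h k h′ k′ t x∉ y∉) bn₁# bn₂# =
    map× (res-Serial h k h′ k′ x∉₁ y∉₁ x∉₂ y∉₂) (res-Serial h k h′ k′ x∉₂ y∉₂ x∉₁ y∉₁)
      (serialise t
        -- Below the restriction the bound names must also avoid `x` and `y`; the side conditions of
        -- Res provide this, as `cn` includes bound names.
        (λ { (z∈ , z∈H) → bn₁# (z∈ , S.H⊆K (λ { refl → x∉₁ (there z∈) }) (λ { refl → y∉₁ (there z∈) }) z∈H) })
        (λ { (z∈ , z∈H) → bn₂# (z∈ , S.H⊆K (λ { refl → x∉₂ (there z∈) }) (λ { refl → y∉₂ (there z∈) }) z∈H) }))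
    where
    module S = Cut h (proj₁ k) (distinct D)
    x∉₁ = x∉ ∘ cn-∥ˡ l₁ l₂
    x∉₂ = x∉ ∘ cn-∥ʳ l₁ l₂
    y∉₁ = y∉ ∘ cn-∥ˡ l₁ l₂
    y∉₂ = y∉ ∘ cn-∥ʳ l₁ l₂

theorem4p18 : (𝒩 : Names) → let open πLL 𝒩 in
    ∀ {n : ℕ} {P P′ : Proc n} {G G′ : HEnv n}
    (D : ⊢ P ∶∶ G) (D′ : ⊢ P′ ∶∶ G′) (l₁ l₂ : Act n) →
    Disjoint (fnᴸ (act l₁)) (fnᴸ (act l₂)) →
    Disjoint (bnᴸ (l₁ ∥ l₂)) (fn (proc D)) →
    D ─⟨ l₁ ∥ l₂ ⟩→ D′ →
    ∃[ P″ ] ∃[ G″ ] Σ[ D″ ∈ ⊢ P″ ∶∶ G″ ]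
    (D ─⟨ act l₁ ⟩→ D″) × (D″ ─⟨ act l₂ ⟩→ D′)
theorem4p18 𝒩 D D′ l₁ l₂ _ bn# t =
  -- Freshness for the free names of `D` is turned into freshness for its hyperenvironment,
  -- separately for each label.
  proj₁ (serialise t (#fn⇒#dom D (++-#⁻ˡ bn#))
                     (#fn⇒#dom D (++-#⁻ʳ (bnᴬ l₁) bn#)))
  where
  open πLL 𝒩 using (bnᴬ)
  open Serialisation 𝒩
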